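{- Let $\Delta$ be a boolean cell complex whose $h$-vector is nonnegative and symmetric. Then the $h$-vector of the barycentric subdivision $\mathrm{sd}(\Delta)$ is symmetric, and the $\gamma$-vector of $\mathrm{sd}(\Delta)$ is the $f$-vector of a balanced simplicial complex.
   Context: A boolean cell complex is a regular cell complex (faces partially ordered by $F\le G$ iff $F$ lies in the closure of $G$, with the empty face below every face) in which every lower interval $[\emptyset,F]$ is isomorphic to a boolean lattice. The barycentric subdivision $\mathrm{sd}(\Delta)$ is the simplicial complex whose vertices are the nonempty faces of $\Delta$ and whose faces are the chains $F_0<F_1<\cdots<F_i$ of nonempty faces. For a $(d-1)$-dimensional complex, $f(\Delta;t)=\sum_{F\in\Delta}t^{1+\dim F}=\sum_{i=0}^d f_i t^i$ (so $f_0=1$ counts the empty face), and the $h$-vector $(h_0,\dots,h_d)$ is defined by $\sum_i h_i t^i=(1-t)^d f(\Delta;t/(1-t))$. The $h$-vector is symmetric if $h_i=h_{d-i}$ for all $i$; then one writes uniquely $\sum_i h_it^i=\sum_{i=0}^{\lfloor d/2\rfloor}\gamma_i t^i(1+t)^{d-2i}$, and $(\gamma_0,\dots,\gamma_{\lfloor d/2\rfloor})$ is the $\gamma$-vector. A $(d-1)$-dimensional simplicial complex is balanced if its vertices can be colored with $d$ colors so that every face has distinctly colored vertices. The $f$-vector of a simplicial complex is $(f_0,f_1,\dots)$ with $f_i$ the number of faces with $i$ vertices, $f_0=1$. -}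

module Defs where

open import Data.Bool.Base using (Bool; true; false; not; _∧_; _∨_)
open import Data.Nat.Base using (ℕ; zero; suc; _∸_; _≤_; _<_; _⊔_; ⌊_/2⌋; _≤ᵇ_)
open import Data.Nat.Base as ℕ using ()
open import Data.Nat.Combinatorics using (_C_)
open import Data.Integer.Base as ℤ using (ℤ; +_; -_)
open import Data.Fin.Base using (Fin)
open import Data.Fin.Properties using (_≟_)
open import Data.Fin.Subset using (Subset; _⊆_; ∣_∣; _∈_)
open import Data.Vec.Base using (Vec; []; _∷_; lookup)
open import Data.List.Base using (List; []; _∷_; _++_; map; length; filterᵇ; allFin; foldr)
open import Data.Product.Base using (Σ; _×_; proj₁)
open import Function.Bundles using (_⇔_)
open import Function.Definitions using (Bijective)
open import Relation.Binary.PropositionalEquality using (_≡_; _≢_)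
open import Relation.Nullary.Decidable.Core using (isYes)

allSubsets : (n : ℕ) → List (Subset n)
allSubsets zero    = [] ∷ []
allSubsets (suc n) = map (true ∷_) (allSubsets n) ++ map (false ∷_) (allSubsets n)

count : {A : Set} → (A → Bool) → List A → ℕ
count p xs = length (filterᵇ p xs)

allB : {A : Set} → (A → Bool) → List A → Bool
allB p = foldr (λ x b → p x ∧ b) true

maxList : List ℕ → ℕ
maxList = foldr _⊔_ 0

_==ℕ_ : ℕ → ℕ → Bool
zero  ==ℕ zero  = true
zero  ==ℕ suc _ = false
suc _ ==ℕ zero  = false
suc m ==ℕ suc n = m ==ℕ n

sumTo : ℕ → (ℕ → ℤ) → ℤ
sumTo zero    g = g 0
sumTo (suc n) g = sumTo n g ℤ.+ g (suc n)

sgn : ℕ → ℤ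
sgn zero          = + 1
sgn (suc zero)    = - (+ 1)
sgn (suc (suc k)) = sgn k

-- Given d and f = (f_0,...,f_d) (f_0 counting the empty face), the
-- h-vector defined by  Σ h_k t^k = (1-t)^d Σ_i f_i t^i (1-t)^{-i},
-- i.e. Σ_i f_i t^i (1-t)^{d-i}; coefficient of t^k:
--   h_k = Σ_{i=0}^{k} (-1)^{k-i} C(d-i, k-i) f_i .
hVec : ℕ → (ℕ → ℕ) → ℕ → ℤ
hVec d f k = sumTo k (λ i → sgn (k ∸ i) ℤ.* (+ ((d ∸ i) C (k ∸ i))) ℤ.* (+ f i))

Symmetric : ℕ → (ℕ → ℤ) → Set
Symmetric d h = ∀ k → k ≤ d → h k ≡ h (d ∸ k)

Nonnegative : ℕ → (ℕ → ℤ) → Set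
Nonnegative d h = ∀ k → k ≤ d → + 0 ℤ.≤ h k

-- coefficient of t^k in t^i (1+t)^(d-2i): C(d-2i, k-i) if i ≤ k, else 0
tPow1pt : ℕ → ℕ → ℕ → ℕ
tPow1pt d i k with i ≤ᵇ k
... | true  = (d ∸ (i ℕ.+ i)) C (k ∸ i)
... | false = 0

-- γ is the γ-vector of the (symmetric) h-vector h of length d+1:
--   Σ_k h_k t^k = Σ_{i=0}^{⌊d/2⌋} γ_i t^i (1+t)^{d-2i}
-- (only γ_0..γ_{⌊d/2⌋} are relevant; the expansion is unique)
IsGammaVector : ℕ → (ℕ → ℤ) → (ℕ → ℤ) → Set
IsGammaVector d h γ =
  ∀ k → k ≤ d → h k ≡ sumTo ⌊ d /2⌋ (λ i → γ i ℤ.* (+ tPow1pt d i k))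

record SimplicialComplex : Set where
  field
    V          : ℕ
    face       : Subset V → Bool
    empty-face : face Data.Fin.Subset.⊥ ≡ true
    down-closed : ∀ σ τ → τ ⊆ σ → face σ ≡ true → face τ ≡ true

-- number of faces with i vertices (f_0 = 1 counts the empty face)
fVecOf : (V : ℕ) → (Subset V → Bool) → ℕ → ℕ
fVecOf V face i = count (λ σ → face σ ∧ (∣ σ ∣ ==ℕ i)) (allSubsets V)

dimPlus1Of : (V : ℕ) → (Subset V → Bool) → ℕ
dimPlus1Of V face = maxList (map (λ σ → if face σ then ∣ σ ∣ else 0) (allSubsets V))
  where open import Data.Bool.Base using (if_then_else_)

module _ (K : SimplicialComplex) where
  open SimplicialComplex K

  fVec : ℕ → ℕ
  fVec = fVecOf V face

  dimPlus1 : ℕ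
  dimPlus1 = dimPlus1Of V face

  Balanced : Set
  Balanced = Σ (Fin V → Fin dimPlus1) λ c →
    ∀ σ → face σ ≡ true → ∀ x y → x ∈ σ → y ∈ σ → c x ≡ c y → x ≡ y

-- Boolean cell complexes, given by their face posets
-- (faces = Fin n, including the empty face bot; F ≼ G iff F ⊆ closure G)

BooleanLowerInterval : {n : ℕ} → (Fin n → Fin n → Bool) → Fin n → ℕ → Set
BooleanLowerInterval {n} _≼_ F r =
  Σ (Σ (Fin n) (λ G → G ≼ F ≡ true) → Subset r) λ φ →
    Bijective _≡_ _≡_ φ ×
    (∀ a b → ((proj₁ a ≼ proj₁ b) ≡ true) ⇔ (φ a ⊆ φ b))

record BooleanCellComplex : Set where
  field
    n        : ℕ
    _≼_      : Fin n → Fin n → Bool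
    ≼-refl   : ∀ x → x ≼ x ≡ true
    ≼-antisym : ∀ x y → x ≼ y ≡ true → y ≼ x ≡ true → x ≡ y
    ≼-trans  : ∀ x y z → x ≼ y ≡ true → y ≼ z ≡ true → x ≼ z ≡ true
    empty    : Fin n
    empty-min : ∀ x → empty ≼ x ≡ true
    -- rank F = 1 + dim F; [empty, F] ≅ boolean lattice B_{rank F}
    rank     : Fin n → ℕ
    boolean  : ∀ F → BooleanLowerInterval _≼_ F (rank F)

module _ (Δ : BooleanCellComplex) where
  open BooleanCellComplex Δ

  fVecΔ : ℕ → ℕ
  fVecΔ i = count (λ F → rank F ==ℕ i) (allFin n)

  dΔ : ℕ
  dΔ = maxList (map rank (allFin n))

  hVecΔ : ℕ → ℤ
  hVecΔ = hVec dΔ fVecΔ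

  -- barycentric subdivision: simplicial complex on the faces of Δ whose
  -- faces are the sets of nonempty faces forming a chain
  sdFace : Subset n → Bool
  sdFace S = allB (λ x → not (lookup S x) ∨
               (not (isYes (x ≟ empty)) ∧
                allB (λ y → not (lookup S y) ∨ (x ≼ y) ∨ (y ≼ x)) (allFin n)))
             (allFin n)

  dSd : ℕ
  dSd = dimPlus1Of n sdFace

  hVecSd : ℕ → ℤ
  hVecSd = hVec dSd (fVecOf n sdFace)

-- Let p_{d,r} be the polynomial Σ t^des(w) over the permutations w of d + 1 letters with
-- w(1) = r + 1. Brenti and Welker's formula reads h(sd Δ) = Σ_r h_r(Δ) p_{d,r}. As h(Δ) is
-- symmetric, only q_r = p_{d,r} + p_{d,d-r} for 2r < d, and p_{d,r} for 2r = d, occur.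
-- With w_r = t p_{d,r} + p_{d,d-r}, the recursion for p becomes a pair of recursions for q
-- and w in which the γ-polynomials only get added, doubled and multiplied by t. Hence the
-- γ-polynomial of q_0 is the f-polynomial of a complex K_d, and for r > 0 that of q_r is t
-- times a sum of f-polynomials of subcomplexes of K_{d-1}: adding to K_d one vertex for
-- each of these subcomplexes, with that link, for r = 1, …, ⌊d/2⌋, gives K_{d+1}. Adding
-- instead h_r copies of the vertices belonging to r gives a complex with the γ-vector of
-- sd Δ. All links lie in K_{d-1}, so the new vertices can share one new colour.
{-# OPTIONS --safe #-}
module Submission where

open import Defs
open import Data.Bool.Base using (Bool; true; false; not; _∧_; _∨_; if_then_else_; T)
open import Data.Nat.Base as ℕ using (ℕ; zero; suc; pred; _∸_; _≤_; _<_; z≤n; s≤s; ⌊_/2⌋; _≤ᵇ_)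
import Data.Nat.Properties as ℕₚ
open import Data.List.Base using (List; []; _∷_; map; _++_; length; allFin)
open import Data.Product.Base using (Σ; ∃; _×_; _,_; proj₁; proj₂)
open import Data.Sum.Base using (_⊎_; inj₁; inj₂)
open import Data.Empty using (⊥-elim)
open import Data.Unit.Base using (tt)
open import Function.Base using (_∘_; id)
open import Relation.Nullary using (Dec; yes; no; ¬_)
open import Relation.Binary.PropositionalEquality

-- Permutations never occur. The formal f-polynomial t^r (1+t)^(d-r) has h-polynomial t^r, so
-- `p d r (d ∸ r)` is defined as the h-polynomial of its subdivision, and splitting one factor 1 + t
-- gives p_{d+1,r} = p_{d+1,r+1} + (1-t) p_{d,r}. The sign is the obstacle: q_{d+1,r+1} = q_{d+1,r}
-- + 2 w_{d,r} - (1+t) q_{d,r} contains a subtraction, which no complex can perform. But q_{d+1,0}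
-- is 1 + t times the sum of all q_{d,s}, the middle one counted once. Iterating from r = 0
-- therefore only takes away summands that are present, and the closed forms `q-unroll` and
-- `w-unroll` are positive. A balanced complex has exactly as many colours as its largest face has
-- vertices. Hence each stage also carries a face of the full size, and each link carries bounds on
-- its sizes and colours; the number of colours grows only at every second step.

-- Finite sums over faces and over subsets, and counting with indicators.

module Summation where
  open import Data.Nat.Base using (_+_; _*_; _^_)
  open import Data.Nat.Tactic.RingSolver using (solve-∀)
  open import Data.Nat.ListAction using (sum)
  open import Data.Fin.Base using (Fin; zero; suc)
  open import Data.Fin.Properties using (_≟_; suc-injective)
  open import Data.Fin.Subset using (Subset; ∣_∣; _⊆_)
  import Data.Fin.Subset.Properties as Subₚ
  open import Data.Vec.Base using ([]; _∷_; lookup; _[_]≔_; here)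
  import Data.Vec.Properties as Vecₚ
  import Data.List.Properties as Listₚ
  open import Data.List.Membership.Propositional using (_∈_)
  open import Data.List.Membership.Propositional.Properties using (∈-++⁺ˡ; ∈-++⁺ʳ; ∈-map⁺)
  open import Data.List.Relation.Unary.Any using (here; there)
  open import Relation.Binary.Definitions using (tri<; tri≈; tri>)
  open import Relation.Nullary.Decidable.Core using (isYes)

  ∑ : {A : Set} → (A → ℕ) → List A → ℕ
  ∑ f xs = sum (map f xs)

  𝟙 : Bool → ℕ
  𝟙 true  = 1
  𝟙 false = 0

  count-∑ : {A : Set} (P : A → Bool) (xs : List A) → count P xs ≡ ∑ (λ x → 𝟙 (P x)) xs
  count-∑ P []       = refl
  count-∑ P (x ∷ xs) with P x
  ... | true  = cong suc (count-∑ P xs)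
  ... | false = count-∑ P xs

  ∑-cong : {A : Set} {f g : A → ℕ} (xs : List A) → (∀ x → f x ≡ g x) → ∑ f xs ≡ ∑ g xs
  ∑-cong []       f≈g = refl
  ∑-cong (x ∷ xs) f≈g = cong₂ _+_ (f≈g x) (∑-cong xs f≈g)

  ∑-zero : {A : Set} {f : A → ℕ} (xs : List A) → (∀ x → f x ≡ 0) → ∑ f xs ≡ 0
  ∑-zero []       f≈0 = refl
  ∑-zero (x ∷ xs) f≈0 = cong₂ _+_ (f≈0 x) (∑-zero xs f≈0)

  ∑-+ : {A : Set} (f g : A → ℕ) (xs : List A) → ∑ (λ x → f x + g x) xs ≡ ∑ f xs + ∑ g xs
  ∑-+ f g []       = refl
  ∑-+ f g (x ∷ xs) = trans (cong (f x + g x +_) (∑-+ f g xs)) (lem (f x) (g x) (∑ f xs) (∑ g xs))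
    where
    lem : ∀ a b c d → (a + b) + (c + d) ≡ (a + c) + (b + d)
    lem = solve-∀

  ∑-*ˡ : {A : Set} (c : ℕ) (f : A → ℕ) (xs : List A) → ∑ (λ x → c * f x) xs ≡ c * ∑ f xs
  ∑-*ˡ c f []       = sym (ℕₚ.*-zeroʳ c)
  ∑-*ˡ c f (x ∷ xs) = trans (cong (c * f x +_) (∑-*ˡ c f xs)) (sym (ℕₚ.*-distribˡ-+ c (f x) _))

  ∑-swap : {A B : Set} (f : A → B → ℕ) (xs : List A) (ys : List B) →
    ∑ (λ x → ∑ (f x) ys) xs ≡ ∑ (λ y → ∑ (λ x → f x y) xs) ys
  ∑-swap f []       ys = sym (∑-zero ys (λ _ → refl))
  ∑-swap f (x ∷ xs) ys = trans (cong (∑ (f x) ys +_) (∑-swap f xs ys)) (sym (∑-+ (f x) _ ys))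

  ∑-map : {A B : Set} (f : B → ℕ) (h : A → B) (xs : List A) → ∑ f (map h xs) ≡ ∑ (f ∘ h) xs
  ∑-map f h []       = refl
  ∑-map f h (x ∷ xs) = cong (f (h x) +_) (∑-map f h xs)

  ∑-++ : {A : Set} (f : A → ℕ) (xs ys : List A) → ∑ f (xs ++ ys) ≡ ∑ f xs + ∑ f ys
  ∑-++ f []       ys = refl
  ∑-++ f (x ∷ xs) ys = trans (cong (f x +_) (∑-++ f xs ys)) (sym (ℕₚ.+-assoc (f x) _ _))

  ∑-positive : {A : Set} (f : A → ℕ) (xs : List A) → 0 < ∑ f xs → ∃ λ x → 0 < f x
  ∑-positive f (x ∷ xs) lt with f x in eq
  ... | suc _ = x , subst (0 <_) (sym eq) (s≤s z≤n)
  ... | zero  = ∑-positive f xs lt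

  ∑-member : {A : Set} (f : A → ℕ) {x : A} {xs : List A} → x ∈ xs → f x ≤ ∑ f xs
  ∑-member f {xs = y ∷ ys} (here refl) = ℕₚ.m≤m+n (f y) _
  ∑-member f {xs = y ∷ ys} (there x∈)  = ℕₚ.≤-trans (∑-member f x∈) (ℕₚ.m≤n+m _ (f y))

  ∑-allFin : ∀ {m} (f : Fin (suc m) → ℕ) → ∑ f (allFin (suc m)) ≡ f zero + ∑ (f ∘ suc) (allFin m)
  ∑-allFin {m} f = cong (f zero +_) (trans (cong (∑ f) (sym (Listₚ.map-tabulate id suc))) (∑-map f suc (allFin m)))

  ∑-allSubsets : ∀ {m} (f : Subset (suc m) → ℕ) →
    ∑ f (allSubsets (suc m)) ≡ ∑ (f ∘ (true ∷_)) (allSubsets m) + ∑ (f ∘ (false ∷_)) (allSubsets m)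
  ∑-allSubsets {m} f = trans (∑-++ f (map (true ∷_) (allSubsets m)) _)
    (cong₂ _+_ (∑-map f (true ∷_) (allSubsets m)) (∑-map f (false ∷_) (allSubsets m)))

  ∈-allSubsets : ∀ {m} (σ : Subset m) → σ ∈ allSubsets m
  ∈-allSubsets []          = here refl
  ∈-allSubsets (true ∷ σ)  = ∈-++⁺ˡ (∈-map⁺ (true ∷_) (∈-allSubsets σ))
  ∈-allSubsets {suc m} (false ∷ σ) =
    ∈-++⁺ʳ (map (true ∷_) (allSubsets m)) (∈-map⁺ (false ∷_) (∈-allSubsets σ))

  bool-iff : ∀ {a b : Bool} → (a ≡ true → b ≡ true) → (b ≡ true → a ≡ true) → a ≡ b
  bool-iff {true}  {b}     f g = sym (f refl)
  bool-iff {false} {true}  f g = g refl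
  bool-iff {false} {false} f g = refl

  absurdᵇ : ∀ {a : Bool} {A : Set} → a ≡ false → a ≡ true → A
  absurdᵇ refl ()

  ≢true⇒false : ∀ {a : Bool} → ¬ a ≡ true → a ≡ false
  ≢true⇒false {true}  a≢ = ⊥-elim (a≢ refl)
  ≢true⇒false {false} a≢ = refl

  ∧-true : ∀ {a b : Bool} → a ∧ b ≡ true → a ≡ true × b ≡ true
  ∧-true {true} {true} _ = refl , refl

  true-∧ : ∀ {a b : Bool} → a ≡ true → b ≡ true → a ∧ b ≡ true
  true-∧ refl refl = refl

  𝟙-∧ : ∀ a b → 𝟙 (a ∧ b) ≡ 𝟙 a * 𝟙 b
  𝟙-∧ true  b = sym (ℕₚ.+-identityʳ (𝟙 b))
  𝟙-∧ false b = refl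

  isYes-refl : ∀ {m} (a : Fin m) → isYes (a ≟ a) ≡ true
  isYes-refl a with a ≟ a
  ... | yes _ = refl
  ... | no a≢ = ⊥-elim (a≢ refl)

  isYes-sound : ∀ {m} {a b : Fin m} → isYes (a ≟ b) ≡ true → a ≡ b
  isYes-sound {a = a} {b} eq with a ≟ b
  ... | yes a≡b = a≡b

  isYes-≢ : ∀ {m} {a b : Fin m} → ¬ a ≡ b → isYes (a ≟ b) ≡ false
  isYes-≢ a≢b = ≢true⇒false (λ eq → a≢b (isYes-sound eq))

  not-isYes⇒≢ : ∀ {m} {a b : Fin m} → not (isYes (a ≟ b)) ≡ true → ¬ a ≡ b
  not-isYes⇒≢ {a = a} e refl = absurdᵇ (cong not (isYes-refl a)) e

  ∑-select : ∀ {m} (a : Fin m) (g : Fin m → ℕ) → ∑ (λ x → 𝟙 (isYes (a ≟ x)) * g x) (allFin m) ≡ g a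
  ∑-select {suc m} zero g = trans (∑-allFin (λ x → 𝟙 (isYes (zero ≟ x)) * g x))
    (trans (cong₂ _+_ (ℕₚ.+-identityʳ (g zero)) (∑-zero (allFin m) (λ x → refl))) (ℕₚ.+-identityʳ (g zero)))
  ∑-select {suc m} (suc a) g = trans (∑-allFin (λ x → 𝟙 (isYes (suc a ≟ x)) * g x))
    (trans (∑-cong (allFin m) (λ x → cong (λ b → 𝟙 b * g (suc x)) (bool-iff
              (λ eq → trans (cong (λ z → isYes (z ≟ x)) (suc-injective (isYes-sound {a = suc a} eq))) (isYes-refl x))
              (λ eq → trans (cong (λ z → isYes (suc z ≟ suc x)) (isYes-sound {a = a} eq)) (isYes-refl (suc x))))))
           (∑-select a (g ∘ suc)))

  ∑-uniqueFin : ∀ {m} (P : Fin m → Bool) a → P a ≡ true → (∀ x → P x ≡ true → a ≡ x) →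
    ∑ (λ x → 𝟙 (P x)) (allFin m) ≡ 1
  ∑-uniqueFin {m} P a Pa uniq = trans
    (∑-cong (allFin m) (λ x → trans (cong 𝟙 (bool-iff
        (λ Px → trans (cong (λ z → isYes (a ≟ z)) (sym (uniq x Px))) (isYes-refl a))
        (λ eq → subst (λ z → P z ≡ true) (isYes-sound eq) Pa)))
      (sym (ℕₚ.*-identityʳ _))))
    (∑-select a (λ _ → 1))

  ∑-uniqueSubset : ∀ {m} (P : Subset m → Bool) σ → P σ ≡ true → (∀ τ → P τ ≡ true → σ ≡ τ) →
    ∑ (λ τ → 𝟙 (P τ)) (allSubsets m) ≡ 1
  ∑-uniqueSubset {zero}  P [] Pσ uniq rewrite Pσ = refl
  ∑-uniqueSubset {suc m} P (true ∷ σ) Pσ uniq = trans (∑-allSubsets (λ τ → 𝟙 (P τ)))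
    (cong₂ _+_ (∑-uniqueSubset (P ∘ (true ∷_)) σ Pσ (λ τ Pτ → Vecₚ.∷-injectiveʳ (uniq (true ∷ τ) Pτ)))
      (∑-zero (allSubsets m) (λ τ → cong 𝟙 (≢true⇒false λ Pτ → case (uniq (false ∷ τ) Pτ)))))
    where
    case : ∀ {τ : Subset m} → ¬ (true ∷ σ ≡ false ∷ τ)
    case ()
  ∑-uniqueSubset {suc m} P (false ∷ σ) Pσ uniq = trans (∑-allSubsets (λ τ → 𝟙 (P τ)))
    (cong₂ _+_ (∑-zero (allSubsets m) (λ τ → cong 𝟙 (≢true⇒false λ Pτ → case (uniq (true ∷ τ) Pτ))))
      (∑-uniqueSubset (P ∘ (false ∷_)) σ Pσ (λ τ Pτ → Vecₚ.∷-injectiveʳ (uniq (false ∷ τ) Pτ))))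
    where
    case : ∀ {τ : Subset m} → ¬ (false ∷ σ ≡ true ∷ τ)
    case ()

  -- `B` may be any Boolean test for inclusion in τ. It will be the face order transported to
  -- subsets, so that the sum counts a lower interval.
  ∑-power : ∀ {r} (τ : Subset r) (B : Subset r → Bool) →
    (∀ σ → B σ ≡ true → σ ⊆ τ) → (∀ σ → σ ⊆ τ → B σ ≡ true) →
    ∑ (λ σ → 𝟙 (B σ)) (allSubsets r) ≡ 2 ^ ∣ τ ∣
  ∑-power []          B to from rewrite from [] (λ x → x) = refl
  ∑-power {suc r} (true ∷ τ)  B to from = trans (∑-allSubsets (λ σ → 𝟙 (B σ))) (cong₂ _+_
    (∑-power τ (B ∘ (true ∷_)) (λ σ e → Subₚ.drop-∷-⊆ (to _ e)) (λ σ σ⊆τ → from _ (Subₚ.s⊆s σ⊆τ)))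
    (trans (∑-power τ (B ∘ (false ∷_)) (λ σ e → Subₚ.drop-∷-⊆ (to _ e)) (λ σ σ⊆τ → from _ (Subₚ.out⊆ σ⊆τ)))
           (sym (ℕₚ.+-identityʳ _))))
  ∑-power {suc r} (false ∷ τ) B to from = trans (∑-allSubsets (λ σ → 𝟙 (B σ))) (cong₂ _+_
    (∑-zero (allSubsets r) (λ σ → cong 𝟙 (≢true⇒false (λ e → absurd (to (true ∷ σ) e)))))
    (∑-power τ (B ∘ (false ∷_)) (λ σ e → Subₚ.drop-∷-⊆ (to _ e)) (λ σ σ⊆τ → from _ (Subₚ.out⊆ σ⊆τ))))
    where
    absurd : ∀ {σ} → ¬ (true ∷ σ ⊆ false ∷ τ)
    absurd σ⊆ with σ⊆ here
    ... | ()

  -- σ ↦ σ ∪ {a} is a bijection from the subsets avoiding a to those containing a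
  ∑-insert : ∀ {m} (a : Fin m) (f g : Subset m → ℕ) →
    (∀ σ → lookup σ a ≡ false → f σ ≡ 0) → (∀ σ → lookup σ a ≡ true → g σ ≡ 0) →
    (∀ σ → lookup σ a ≡ false → f (σ [ a ]≔ true) ≡ g σ) →
    ∑ f (allSubsets m) ≡ ∑ g (allSubsets m)
  ∑-insert {suc m} zero f g f0 g0 fg = trans (∑-allSubsets f) (trans
    (trans (cong₂ _+_ (∑-cong (allSubsets m) (λ σ → fg (false ∷ σ) refl))
                      (∑-zero (allSubsets m) (λ σ → f0 (false ∷ σ) refl)))
      (trans (ℕₚ.+-comm _ 0) (cong (_+ ∑ (g ∘ (false ∷_)) (allSubsets m))
        (sym (∑-zero (allSubsets m) (λ σ → g0 (true ∷ σ) refl))))))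
    (sym (∑-allSubsets g)))
  ∑-insert {suc m} (suc a) f g f0 g0 fg = trans (∑-allSubsets f) (trans
    (cong₂ _+_ (∑-insert a (f ∘ (true ∷_)) (g ∘ (true ∷_)) (λ σ → f0 (true ∷ σ)) (λ σ → g0 (true ∷ σ)) (λ σ → fg (true ∷ σ)))
               (∑-insert a (f ∘ (false ∷_)) (g ∘ (false ∷_)) (λ σ → f0 (false ∷ σ)) (λ σ → g0 (false ∷ σ)) (λ σ → fg (false ∷ σ))))
    (sym (∑-allSubsets g)))

  ∣insert∣ : ∀ {m} (a : Fin m) (σ : Subset m) → lookup σ a ≡ false → ∣ σ [ a ]≔ true ∣ ≡ suc ∣ σ ∣
  ∣insert∣ zero    (false ∷ σ) _  = refl
  ∣insert∣ (suc a) (true ∷ σ)  eq = cong suc (∣insert∣ a σ eq)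
  ∣insert∣ (suc a) (false ∷ σ) eq = ∣insert∣ a σ eq

  ∣σ∣>0 : ∀ {m j} (σ : Subset m) → ∣ σ ∣ ≡ suc j → ∃ λ x → lookup σ x ≡ true
  ∣σ∣>0 (true ∷ σ)  _  = zero , refl
  ∣σ∣>0 (false ∷ σ) eq with ∣σ∣>0 σ eq
  ... | x , x∈σ = suc x , x∈σ

  allB-sound : {A : Set} (P : A → Bool) (xs : List A) → allB P xs ≡ true → ∀ {x} → x ∈ xs → P x ≡ true
  allB-sound P (x ∷ xs) eq (here refl) = proj₁ (∧-true {P x} eq)
  allB-sound P (x ∷ xs) eq (there x∈)  = allB-sound P xs (proj₂ (∧-true {P x} eq)) x∈

  allB-complete : {A : Set} (P : A → Bool) (xs : List A) → (∀ x → P x ≡ true) → allB P xs ≡ true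
  allB-complete P []       all = refl
  allB-complete P (x ∷ xs) all = true-∧ (all x) (allB-complete P xs all)

  maxList-upper : {A : Set} (f : A → ℕ) (xs : List A) {m : ℕ} → (∀ x → f x ≤ m) → maxList (map f xs) ≤ m
  maxList-upper f []       f≤m = z≤n
  maxList-upper f (x ∷ xs) f≤m = ℕₚ.⊔-lub (f≤m x) (maxList-upper f xs f≤m)

  maxList-member : {A : Set} (f : A → ℕ) {xs : List A} {x : A} → x ∈ xs → f x ≤ maxList (map f xs)
  maxList-member f {y ∷ ys} (here refl) = ℕₚ.m≤m⊔n (f y) _
  maxList-member f {y ∷ ys} (there x∈)  = ℕₚ.≤-trans (maxList-member f x∈) (ℕₚ.m≤n⊔m (f y) _)

  2^-injective : ∀ a b → 2 ^ a ≡ 2 ^ b → a ≡ b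
  2^-injective a b eq with ℕₚ.<-cmp a b
  ... | tri< a<b _ _ = ⊥-elim (ℕₚ.<⇒≢ (ℕₚ.^-monoʳ-< 2 (s≤s (s≤s z≤n)) a<b) eq)
  ... | tri≈ _ a≡b _ = a≡b
  ... | tri> _ _ b<a = ⊥-elim (ℕₚ.<⇒≢ (ℕₚ.^-monoʳ-< 2 (s≤s (s≤s z≤n)) b<a) (sym eq))

open Summation

-- Coefficient sequences, and all identities between h-polynomials.

module Polynomials where
  open import Data.Nat.Combinatorics using (_C_; nCk+nC[k+1]≡[n+1]C[k+1]; nCk≡nC[n∸k]; k>n⇒nCk≡0)
  import Data.Nat.Tactic.RingSolver as ℕ-ring
  open import Data.Integer.Base using (ℤ; +_; -_; _+_; _*_; _-_)
  import Data.Integer.Properties as ℤₚ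
  open import Data.Integer.Tactic.RingSolver using (solve-∀)
  open import Algebra.Properties.AbelianGroup ℤₚ.+-0-abelianGroup using () renaming (∙-cancelʳ to +-cancelʳ)
  open import Data.List.Relation.Unary.All using (All; []; _∷_)

  infixl 8 _↑

  -- multiplication by t on coefficient sequences
  _↑ : (ℕ → ℤ) → ℕ → ℤ
  (a ↑) zero    = + 0
  (a ↑) (suc k) = a k

  ↑-cong : ∀ {a b : ℕ → ℤ} → (∀ k → a k ≡ b k) → ∀ k → (a ↑) k ≡ (b ↑) k
  ↑-cong a≈b zero    = refl
  ↑-cong a≈b (suc k) = a≈b k

  ↑-+ : ∀ (a b : ℕ → ℤ) k → ((λ i → a i + b i) ↑) k ≡ (a ↑) k + (b ↑) k
  ↑-+ a b zero    = refl
  ↑-+ a b (suc k) = refl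

  sumTo-cong : ∀ n {f g : ℕ → ℤ} → (∀ i → i ≤ n → f i ≡ g i) → sumTo n f ≡ sumTo n g
  sumTo-cong zero    eq = eq 0 z≤n
  sumTo-cong (suc n) eq =
    cong₂ _+_ (sumTo-cong n (λ i i≤n → eq i (ℕₚ.m≤n⇒m≤1+n i≤n))) (eq (suc n) ℕₚ.≤-refl)

  +-interchange : ∀ a b c d → (a + b) + (c + d) ≡ (a + c) + (b + d)
  +-interchange = solve-∀

  sumTo-+ : ∀ n (f g : ℕ → ℤ) → sumTo n (λ i → f i + g i) ≡ sumTo n f + sumTo n g
  sumTo-+ zero    f g = refl
  sumTo-+ (suc n) f g = trans (cong (_+ (f (suc n) + g (suc n))) (sumTo-+ n f g))
    (+-interchange (sumTo n f) (sumTo n g) (f (suc n)) (g (suc n)))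

  sumTo-neg : ∀ n (f : ℕ → ℤ) → sumTo n (λ i → - f i) ≡ - sumTo n f
  sumTo-neg zero    f = refl
  sumTo-neg (suc n) f = trans (cong (_+ - f (suc n)) (sumTo-neg n f))
    (sym (ℤₚ.neg-distrib-+ (sumTo n f) (f (suc n))))

  sumTo-zero : ∀ n {f : ℕ → ℤ} → (∀ i → i ≤ n → f i ≡ + 0) → sumTo n f ≡ + 0
  sumTo-zero zero    eq = eq 0 z≤n
  sumTo-zero (suc n) eq =
    cong₂ _+_ (sumTo-zero n (λ i i≤n → eq i (ℕₚ.m≤n⇒m≤1+n i≤n))) (eq (suc n) ℕₚ.≤-refl)

  sumTo-head : ∀ n (f : ℕ → ℤ) → sumTo (suc n) f ≡ f 0 + sumTo n (λ i → f (suc i))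
  sumTo-head zero    f = refl
  sumTo-head (suc n) f = trans (cong (_+ f (suc (suc n))) (sumTo-head n f))
    (ℤₚ.+-assoc (f 0) (sumTo n (λ i → f (suc i))) (f (suc (suc n))))

  -- Summation by parts with its boundary term. In `hVec-osp` the differences of `b` are (1-t)
  -- p_{d,r}, and taking differences of `c` multiplies an h-polynomial by 1 - t.
  abel : ∀ d (c b : ℕ → ℤ) →
    sumTo d (λ k → c k * (b k - b (suc k))) + c (suc d) * b (suc d)
      ≡ sumTo (suc d) (λ k → (c k - (c ↑) k) * b k)
  abel zero c b = lem (c 0) (c 1) (b 0) (b 1)
    where
    lem : ∀ c₀ c₁ b₀ b₁ → c₀ * (b₀ + - b₁) + c₁ * b₁ ≡ (c₀ + + 0) * b₀ + (c₁ + - c₀) * b₁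
    lem = solve-∀
  abel (suc d) c b = trans
    (lem (sumTo d (λ k → c k * (b k - b (suc k)))) (c (suc d)) (b (suc d)) (b (suc (suc d))) (c (suc (suc d))))
    (cong (_+ (c (suc (suc d)) - c (suc d)) * b (suc (suc d))) (abel d c b))
    where
    lem : ∀ s c₁ b₁ b₂ c₂ → (s + c₁ * (b₁ + - b₂)) + c₂ * b₂ ≡ (s + c₁ * b₁) + (c₂ + - c₁) * b₂
    lem = solve-∀

  -- The h-vector as an additive function of the f-vector.

  sgn-suc : ∀ m → sgn (suc m) ≡ - sgn m
  sgn-suc zero          = refl
  sgn-suc (suc zero)    = refl
  sgn-suc (suc (suc m)) = sgn-suc m

  shiftℕ : (ℕ → ℕ) → ℕ → ℕ
  shiftℕ f zero    = 0
  shiftℕ f (suc i) = f i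

  hVec-cong : ∀ d {f g : ℕ → ℕ} → (∀ i → f i ≡ g i) → ∀ k → hVec d f k ≡ hVec d g k
  hVec-cong d f≈g k =
    sumTo-cong k (λ i _ → cong (λ z → sgn (k ∸ i) * + ((d ∸ i) C (k ∸ i)) * + z) (f≈g i))

  hVec-+ : ∀ d (f g : ℕ → ℕ) k → hVec d (λ i → f i ℕ.+ g i) k ≡ hVec d f k + hVec d g k
  hVec-+ d f g k = trans
    (sumTo-cong k (λ i _ →
      trans (cong (sgn (k ∸ i) * + ((d ∸ i) C (k ∸ i)) *_) (ℤₚ.pos-+ (f i) (g i)))
            (ℤₚ.*-distribˡ-+ (sgn (k ∸ i) * + ((d ∸ i) C (k ∸ i))) (+ f i) (+ g i))))
    (sumTo-+ k _ _)

  hVec-zero : ∀ d k → hVec d (λ _ → 0) k ≡ + 0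
  hVec-zero d k = sumTo-zero k (λ i _ → ℤₚ.*-zeroʳ (sgn (k ∸ i) * + ((d ∸ i) C (k ∸ i))))

  -- (1-t) · t/(1-t) = t
  hVec-shift : ∀ d f k → hVec (suc d) (shiftℕ f) k ≡ (hVec d f ↑) k
  hVec-shift d f zero    = ℤₚ.*-zeroʳ (sgn 0 * + (suc d C 0))
  hVec-shift d f (suc k) = trans (sumTo-head k _)
    (trans (cong (_+ hVec d f k) (ℤₚ.*-zeroʳ (sgn (suc k) * + (suc d C suc k))))
           (ℤₚ.+-identityˡ (hVec d f k)))

  -- Reading the same f-vector one dimension higher multiplies h by 1 - t. This is Pascal's rule as
  -- long as i ≤ d; beyond that `d ∸ i` is truncated, and the degree hypothesis removes those terms.
  hVec-suc : ∀ d f → (∀ i → d < i → f i ≡ 0) → ∀ k →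
    hVec (suc d) f k ≡ hVec d f k - (hVec d f ↑) k
  hVec-suc d f deg zero    = sym (ℤₚ.+-identityʳ _)
  hVec-suc d f deg (suc k) = begin
    sumTo k (λ i → sgn (suc k ∸ i) * + ((suc d ∸ i) C (suc k ∸ i)) * + f i)
        + sgn (k ∸ k) * + ((d ∸ k) C (k ∸ k)) * + f (suc k)
      ≡⟨ cong₂ _+_ (sumTo-cong k term) last ⟩
    sumTo k (λ i → A i + - B i) + L
      ≡⟨ cong (_+ L) (trans (sumTo-+ k A (λ i → - B i)) (cong (λ z → sumTo k A + z) (sumTo-neg k B))) ⟩
    (sumTo k A + - sumTo k B) + L
      ≡⟨ swap (sumTo k A) (- sumTo k B) L ⟩
    (sumTo k A + L) + - sumTo k B ∎
    where
    open ≡-Reasoning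
    A B : ℕ → ℤ
    A i = sgn (suc k ∸ i) * + ((d ∸ i) C (suc k ∸ i)) * + f i
    B i = sgn (k ∸ i) * + ((d ∸ i) C (k ∸ i)) * + f i
    L : ℤ
    L = sgn (k ∸ k) * + ((d ∸ suc k) C (k ∸ k)) * + f (suc k)
    swap : ∀ a b c → (a + b) + c ≡ (a + c) + b
    swap = solve-∀
    -- For i = k + 1 the lower index is 0, so both binomials are 1 although their upper indices may
    -- differ.
    last : sgn (k ∸ k) * + ((d ∸ k) C (k ∸ k)) * + f (suc k) ≡ L
    last rewrite ℕₚ.n∸n≡0 k = refl
    distr : ∀ s x y z → (- s) * (x + y) * z ≡ (- s) * y * z + - (s * x * z)
    distr = solve-∀
    term : ∀ i → i ≤ k →
      sgn (suc k ∸ i) * + ((suc d ∸ i) C (suc k ∸ i)) * + f i ≡ A i + - B i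
    term i i≤k with i ℕₚ.≤? d
    ... | yes i≤d
      rewrite ℕₚ.+-∸-assoc 1 i≤d | ℕₚ.+-∸-assoc 1 i≤k
            | sym (nCk+nC[k+1]≡[n+1]C[k+1] (d ∸ i) (k ∸ i)) | sgn-suc (k ∸ i)
            | ℤₚ.pos-+ ((d ∸ i) C (k ∸ i)) ((d ∸ i) C (suc (k ∸ i)))
      = distr (sgn (k ∸ i)) (+ ((d ∸ i) C (k ∸ i))) (+ ((d ∸ i) C (suc (k ∸ i)))) (+ f i)
    ... | no i≰d rewrite deg i (ℕₚ.≰⇒> i≰d)
      | ℤₚ.*-zeroʳ (sgn (suc k ∸ i) * + ((suc d ∸ i) C (suc k ∸ i)))
      | ℤₚ.*-zeroʳ (sgn (suc k ∸ i) * + ((d ∸ i) C (suc k ∸ i)))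
      | ℤₚ.*-zeroʳ (sgn (k ∸ i) * + ((d ∸ i) C (k ∸ i))) = refl

  -- The basis t^i (1+t)^(d-2i) and γ-expansions.

  tPow-≤ : ∀ d {i k} → i ≤ k → tPow1pt d i k ≡ (d ∸ (i ℕ.+ i)) C (k ∸ i)
  tPow-≤ d {i} {k} i≤k with i ≤ᵇ k | ℕₚ.≤⇒≤ᵇ i≤k
  ... | true | _ = refl

  tPow-> : ∀ d {i k} → k < i → tPow1pt d i k ≡ 0
  tPow-> d {i} {k} k<i with i ≤ᵇ k in eq
  ... | false = refl
  ... | true  = ⊥-elim (ℕₚ.<⇒≱ k<i (ℕₚ.≤ᵇ⇒≤ i k (subst T (sym eq) tt)))

  tPow-shift : ∀ d i k → tPow1pt (suc (suc d)) (suc i) (suc k) ≡ tPow1pt d i k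
  tPow-shift d i k with i ℕₚ.≤? k
  ... | yes i≤k rewrite tPow-≤ (suc (suc d)) (s≤s i≤k) | tPow-≤ d i≤k | ℕₚ.+-suc i i = refl
  ... | no i≰k rewrite tPow-> (suc (suc d)) (s≤s (ℕₚ.≰⇒> i≰k)) | tPow-> d (ℕₚ.≰⇒> i≰k) = refl

  -- Multiplication by 1 + t, by Pascal's rule. The bound keeps `d ∸ (i + i)` an honest difference,
  -- which grows with d.
  tPow-suc : ∀ d i → i ℕ.+ i ≤ d → ∀ k →
    + tPow1pt (suc d) i k ≡ + tPow1pt d i k + ((λ j → + tPow1pt d i j) ↑) k
  tPow-suc d zero    2i≤d zero = refl
  tPow-suc d (suc i) 2i≤d zero = refl
  tPow-suc d i 2i≤d (suc k) with i ℕₚ.≤? k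
  ... | yes i≤k
    rewrite tPow-≤ (suc d) (ℕₚ.m≤n⇒m≤1+n i≤k) | tPow-≤ d (ℕₚ.m≤n⇒m≤1+n i≤k) | tPow-≤ d i≤k
          | ℕₚ.+-∸-assoc 1 2i≤d | ℕₚ.+-∸-assoc 1 i≤k
          | sym (nCk+nC[k+1]≡[n+1]C[k+1] (d ∸ (i ℕ.+ i)) (k ∸ i))
    = cong +_ (ℕₚ.+-comm ((d ∸ (i ℕ.+ i)) C (k ∸ i)) _)
  ... | no i≰k with i ℕₚ.≟ suc k
  ...   | yes refl rewrite tPow-≤ (suc d) (ℕₚ.≤-refl {i}) | tPow-≤ d (ℕₚ.≤-refl {i})
                         | tPow-> d (ℕₚ.≰⇒> i≰k) | ℕₚ.n∸n≡0 k = refl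
  ...   | no i≢ rewrite tPow-> (suc d) (ℕₚ.≤∧≢⇒< (ℕₚ.≰⇒> i≰k) (λ e → i≢ (sym e)))
                      | tPow-> d (ℕₚ.≤∧≢⇒< (ℕₚ.≰⇒> i≰k) (λ e → i≢ (sym e)))
                      | tPow-> d (ℕₚ.≰⇒> i≰k) = refl

  -- If k and d - k are both at least i, this is the symmetry of binomials. If only one of them is,
  -- its binomial vanishes because the lower index exceeds the upper one.
  tPow-sym : ∀ d i k → i ℕ.+ i ≤ d → k ≤ d → tPow1pt d i (d ∸ k) ≡ tPow1pt d i k
  tPow-sym d i k 2i≤d k≤d with i ℕₚ.≤? k | i ℕₚ.≤? (d ∸ k)
  ... | yes i≤k | yes i≤d∸k rewrite tPow-≤ d i≤k | tPow-≤ d i≤d∸k =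
    trans (cong ((d ∸ (i ℕ.+ i)) C_) eq) (sym (nCk≡nC[n∸k] bound))
    where
    open ≡-Reasoning
    k+i≤d : k ℕ.+ i ≤ d
    k+i≤d = subst (k ℕ.+ i ≤_) (ℕₚ.m+[n∸m]≡n k≤d) (ℕₚ.+-monoʳ-≤ k i≤d∸k)
    eq : d ∸ k ∸ i ≡ d ∸ (i ℕ.+ i) ∸ (k ∸ i)
    eq = begin
      d ∸ k ∸ i                   ≡⟨ ℕₚ.∸-+-assoc d k i ⟩
      d ∸ (k ℕ.+ i)               ≡⟨ cong (d ∸_) (ℕₚ.+-comm k i) ⟩
      d ∸ (i ℕ.+ k)               ≡⟨ cong (λ z → d ∸ (i ℕ.+ z)) (ℕₚ.m+[n∸m]≡n i≤k) ⟨
      d ∸ (i ℕ.+ (i ℕ.+ (k ∸ i))) ≡⟨ cong (d ∸_) (ℕₚ.+-assoc i i (k ∸ i)) ⟨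
      d ∸ (i ℕ.+ i ℕ.+ (k ∸ i))   ≡⟨ ℕₚ.∸-+-assoc d (i ℕ.+ i) (k ∸ i) ⟨
      d ∸ (i ℕ.+ i) ∸ (k ∸ i)     ∎
    bound : k ∸ i ≤ d ∸ (i ℕ.+ i)
    bound = subst (_≤ d ∸ (i ℕ.+ i)) (trans (cong (_∸ (i ℕ.+ i)) (ℕₚ.+-comm k i)) (ℕₚ.[m+n]∸[m+o]≡n∸o i k i))
              (ℕₚ.∸-monoˡ-≤ (i ℕ.+ i) k+i≤d)
  ... | no i≰k | yes i≤d∸k rewrite tPow-> d (ℕₚ.≰⇒> i≰k) | tPow-≤ d i≤d∸k = k>n⇒nCk≡0
    (subst (d ∸ (i ℕ.+ i) <_) (sym (ℕₚ.∸-+-assoc d k i))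
      (ℕₚ.∸-monoʳ-< (ℕₚ.+-monoˡ-< i (ℕₚ.≰⇒> i≰k)) 2i≤d))
  ... | yes i≤k | no i≰d∸k rewrite tPow-> d (ℕₚ.≰⇒> i≰d∸k) | tPow-≤ d i≤k = sym (k>n⇒nCk≡0
    (subst (_< k ∸ i) (ℕₚ.∸-+-assoc d i i) (ℕₚ.∸-monoˡ-< lt i≤d∸i)))
    where
    i≤d∸i : i ≤ d ∸ i
    i≤d∸i = subst (_≤ d ∸ i) (ℕₚ.m+n∸n≡m i i) (ℕₚ.∸-monoˡ-≤ i 2i≤d)
    lt : d ∸ i < k
    lt = ℕₚ.+-cancelʳ-< i (d ∸ i) k (subst (_< k ℕ.+ i) (sym (ℕₚ.m∸n+n≡m (ℕₚ.≤-trans (ℕₚ.m≤m+n i i) 2i≤d)))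
           (subst (_< k ℕ.+ i) (ℕₚ.m+[n∸m]≡n k≤d) (ℕₚ.+-monoʳ-< k (ℕₚ.≰⇒> i≰d∸k))))
  ... | no i≰k | no i≰d∸k rewrite tPow-> d (ℕₚ.≰⇒> i≰k) | tPow-> d (ℕₚ.≰⇒> i≰d∸k) = refl

  ⌊n/2⌋+⌊n/2⌋≤n : ∀ n → ⌊ n /2⌋ ℕ.+ ⌊ n /2⌋ ≤ n
  ⌊n/2⌋+⌊n/2⌋≤n zero          = z≤n
  ⌊n/2⌋+⌊n/2⌋≤n (suc zero)    = z≤n
  ⌊n/2⌋+⌊n/2⌋≤n (suc (suc n)) =
    s≤s (subst (_≤ suc n) (sym (ℕₚ.+-suc ⌊ n /2⌋ ⌊ n /2⌋)) (s≤s (⌊n/2⌋+⌊n/2⌋≤n n)))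

  i≤⌊n/2⌋⇒i+i≤n : ∀ n {i} → i ≤ ⌊ n /2⌋ → i ℕ.+ i ≤ n
  i≤⌊n/2⌋⇒i+i≤n n i≤ = ℕₚ.≤-trans (ℕₚ.+-mono-≤ i≤ i≤) (⌊n/2⌋+⌊n/2⌋≤n n)

  i+i≤n⇒i≤⌊n/2⌋ : ∀ n {i} → i ℕ.+ i ≤ n → i ≤ ⌊ n /2⌋
  i+i≤n⇒i≤⌊n/2⌋ n {i} 2i≤n = subst (_≤ ⌊ n /2⌋) (sym (ℕₚ.n≡⌊n+n/2⌋ i)) (ℕₚ.⌊n/2⌋-mono 2i≤n)

  -- the polynomial Σ gᵢ tⁱ (1+t)^(d-2i)
  Φ : ℕ → (ℕ → ℕ) → ℕ → ℤ
  Φ d g k = sumTo ⌊ d /2⌋ (λ i → + g i * + tPow1pt d i k)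

  Φ-cong : ∀ d {f g : ℕ → ℕ} → (∀ i → f i ≡ g i) → ∀ k → Φ d f k ≡ Φ d g k
  Φ-cong d f≈g k = sumTo-cong ⌊ d /2⌋ (λ i _ → cong (λ z → + z * + tPow1pt d i k) (f≈g i))

  Φ-+ : ∀ d f g k → Φ d (λ i → f i ℕ.+ g i) k ≡ Φ d f k + Φ d g k
  Φ-+ d f g k = trans
    (sumTo-cong ⌊ d /2⌋ (λ i _ → trans (cong (_* + tPow1pt d i k) (ℤₚ.pos-+ (f i) (g i)))
                                       (ℤₚ.*-distribʳ-+ (+ tPow1pt d i k) (+ f i) (+ g i))))
    (sumTo-+ ⌊ d /2⌋ _ _)

  Φ-zero : ∀ d k → Φ d (λ _ → 0) k ≡ + 0
  Φ-zero d k = sumTo-zero ⌊ d /2⌋ (λ i _ → ℤₚ.*-zeroˡ (+ tPow1pt d i k))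

  Φ-sym : ∀ d g k → k ≤ d → Φ d g k ≡ Φ d g (d ∸ k)
  Φ-sym d g k k≤d = sumTo-cong ⌊ d /2⌋ (λ i i≤ →
    cong (λ z → + g i * + z) (sym (tPow-sym d i k (i≤⌊n/2⌋⇒i+i≤n d i≤) k≤d)))

  -- Since d + 2 - 2(i+1) = d - 2i, multiplication by t raises d by two and multiplies the
  -- γ-polynomial by t.
  Φ-shift : ∀ d g k → Φ (suc (suc d)) (shiftℕ g) k ≡ (Φ d g ↑) k
  Φ-shift d g zero = sumTo-zero (suc ⌊ d /2⌋) term
    where
    term : ∀ i → i ≤ suc ⌊ d /2⌋ → + shiftℕ g i * + tPow1pt (suc (suc d)) i 0 ≡ + 0
    term zero    _ = ℤₚ.*-zeroˡ (+ tPow1pt (suc (suc d)) 0 0)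
    term (suc i) _ = ℤₚ.*-zeroʳ (+ g i)
  Φ-shift d g (suc k) = trans (sumTo-head ⌊ d /2⌋ _)
    (trans (cong₂ _+_ (ℤₚ.*-zeroˡ (+ tPow1pt (suc (suc d)) 0 (suc k)))
                      (sumTo-cong ⌊ d /2⌋ (λ i _ → cong (λ z → + g i * + z) (tPow-shift d i k))))
           (ℤₚ.+-identityˡ (Φ d g k)))

  -- Multiplication by 1 + t raises d by one and leaves the γ-polynomial alone. The range of
  -- summation may gain an index, whose coefficient is zero by the degree hypothesis.
  Φ-suc : ∀ d g → (∀ i → d < i ℕ.+ i → g i ≡ 0) → ∀ k →
    Φ (suc d) g k ≡ Φ d g k + (Φ d g ↑) k
  Φ-suc d g deg k = trans (longer k) (trans (sumTo-cong ⌊ d /2⌋ term) (split k))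
    where
    wide : ∀ m n → (∀ i → n < i → g i ≡ 0) → n ≤ m → ∀ (c : ℕ → ℤ) →
      sumTo m (λ i → + g i * c i) ≡ sumTo n (λ i → + g i * c i)
    wide m n g0 n≤m c with n ℕₚ.≟ m
    ... | yes refl = refl
    wide zero    n g0 n≤m c | no n≢m = ⊥-elim (n≢m (ℕₚ.n≤0⇒n≡0 n≤m))
    wide (suc m) n g0 n≤m c | no n≢m with ℕₚ.≤∧≢⇒< n≤m n≢m
    ... | s≤s n≤m′ rewrite g0 (suc m) (s≤s n≤m′) | ℤₚ.*-zeroˡ (c (suc m)) =
      trans (ℤₚ.+-identityʳ _) (wide m n g0 n≤m′ c)
    vanish : ∀ i → ⌊ d /2⌋ < i → g i ≡ 0
    vanish i lt = deg i (ℕₚ.≰⇒> (λ 2i≤d → ℕₚ.<⇒≱ lt (i+i≤n⇒i≤⌊n/2⌋ d 2i≤d)))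
    longer : ∀ k → Φ (suc d) g k ≡ sumTo ⌊ d /2⌋ (λ i → + g i * + tPow1pt (suc d) i k)
    longer k = wide ⌊ suc d /2⌋ ⌊ d /2⌋ vanish (ℕₚ.⌊n/2⌋-mono (ℕₚ.n≤1+n d)) (λ i → + tPow1pt (suc d) i k)
    term : ∀ i → i ≤ ⌊ d /2⌋ → + g i * + tPow1pt (suc d) i k ≡
             + g i * + tPow1pt d i k + + g i * ((λ j → + tPow1pt d i j) ↑) k
    term i i≤ = trans (cong (+ g i *_) (tPow-suc d i (i≤⌊n/2⌋⇒i+i≤n d i≤) k))
                      (ℤₚ.*-distribˡ-+ (+ g i) _ _)
    split : ∀ k → sumTo ⌊ d /2⌋ (λ i → + g i * + tPow1pt d i k + + g i * ((λ j → + tPow1pt d i j) ↑) k)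
              ≡ Φ d g k + (Φ d g ↑) k
    split zero    = trans (sumTo-+ ⌊ d /2⌋ _ _)
      (cong (λ z → Φ d g 0 + z) (sumTo-zero ⌊ d /2⌋ (λ i _ → ℤₚ.*-zeroʳ (+ g i))))
    split (suc k) = sumTo-+ ⌊ d /2⌋ _ _

  -- Chains in boolean lattices.

  -- Σ_{i ≤ e} C(e,i) aᵢ, by Pascal's rule
  binSum : ℕ → (ℕ → ℕ) → ℕ
  binSum zero    a = a 0
  binSum (suc e) a = binSum e (a ∘ suc) ℕ.+ binSum e a

  -- Σ_{i < e} C(e,i) aᵢ
  binSum< : ℕ → (ℕ → ℕ) → ℕ
  binSum< zero    a = 0
  binSum< (suc e) a = binSum< e (a ∘ suc) ℕ.+ binSum e a

  binSum-last : ∀ e a → binSum e a ≡ binSum< e a ℕ.+ a e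
  binSum-last zero    a = refl
  binSum-last (suc e) a = trans (cong (ℕ._+ binSum e a) (binSum-last e (a ∘ suc)))
    (lem (binSum< e (a ∘ suc)) (a (suc e)) (binSum e a))
    where
    lem : ∀ x y z → (x ℕ.+ y) ℕ.+ z ≡ (x ℕ.+ z) ℕ.+ y
    lem = ℕ-ring.solve-∀

  binSum-cong : ∀ e {a b} → (∀ i → a i ≡ b i) → binSum e a ≡ binSum e b
  binSum-cong zero    a≈b = a≈b 0
  binSum-cong (suc e) a≈b = cong₂ ℕ._+_ (binSum-cong e (a≈b ∘ suc)) (binSum-cong e a≈b)

  binSum-zero : ∀ e {a} → (∀ i → i ≤ e → a i ≡ 0) → binSum e a ≡ 0
  binSum-zero zero    a≈0 = a≈0 0 z≤n
  binSum-zero (suc e) a≈0 =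
    cong₂ ℕ._+_ (binSum-zero e (λ i i≤e → a≈0 (suc i) (s≤s i≤e)))
                (binSum-zero e (λ i i≤e → a≈0 i (ℕₚ.m≤n⇒m≤1+n i≤e)))

  binSum<-zero : ∀ e {a} → (∀ i → i < e → a i ≡ 0) → binSum< e a ≡ 0
  binSum<-zero zero    a≈0 = refl
  binSum<-zero (suc e) a≈0 =
    cong₂ ℕ._+_ (binSum<-zero e (λ i i<e → a≈0 (suc i) (s≤s i<e)))
                (binSum-zero e (λ i i≤e → a≈0 i (s≤s i≤e)))

  δ₀ : ℕ → ℕ
  δ₀ zero    = 1
  δ₀ (suc _) = 0

  -- the number of ordered partitions of an i-set into j nonempty blocks
  osp : ℕ → ℕ → ℕ
  osp i zero    = δ₀ i
  osp i (suc j) = binSum< i (λ i′ → osp i′ j)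

  osp-zero : ∀ {i j} → i < j → osp i j ≡ 0
  osp-zero {i} {suc j} (s≤s i≤j) =
    binSum<-zero i (λ i′ i′<i → osp-zero (ℕₚ.<-≤-trans i′<i i≤j))

  osp-diag : ∀ i → 0 < osp i i
  osp-diag zero    = s≤s z≤n
  osp-diag (suc i) = ℕₚ.<-≤-trans (osp-diag i)
    (ℕₚ.≤-trans (ℕₚ.≤-trans (ℕₚ.m≤n+m (osp i i) (binSum< i (λ i′ → osp i′ i)))
                            (ℕₚ.≤-reflexive (sym (binSum-last i (λ i′ → osp i′ i)))))
                (ℕₚ.m≤n+m _ (binSum< i (λ i′ → osp (suc i′) i))))

  -- the f-vector of the subdivision of a formal complex with f-polynomial t^r (1+t)^e
  sdF : ℕ → ℕ → ℕ → ℕ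
  sdF r zero    j = osp r j
  sdF r (suc e) j = sdF (suc r) e j ℕ.+ sdF r e j

  sdF-zero : ∀ r e {j} → r ℕ.+ e < j → sdF r e j ≡ 0
  sdF-zero r zero    {j} lt = osp-zero (subst (_< j) (ℕₚ.+-identityʳ r) lt)
  sdF-zero r (suc e) {j} lt = cong₂ ℕ._+_
    (sdF-zero (suc r) e (subst (_< j) (ℕₚ.+-suc r e) lt))
    (sdF-zero r e (ℕₚ.<-trans (ℕₚ.+-monoʳ-< r (ℕₚ.n<1+n e)) lt))

  sdF-binSum : ∀ r e j → sdF r e j ≡ binSum e (λ i → osp (i ℕ.+ r) j)
  sdF-binSum r zero    j = refl
  sdF-binSum r (suc e) j = cong₂ ℕ._+_
    (trans (sdF-binSum (suc r) e j) (binSum-cong e (λ i → cong (λ z → osp z j) (ℕₚ.+-suc i r))))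
    (sdF-binSum r e j)

  -- For d > 0, a chain of j nonempty members of the boolean lattice of rank d either ends at the
  -- top or can be prolonged by it.
  sdF-boolean : ∀ d j → sdF 0 d j ≡ osp d j ℕ.+ osp d (suc j)
  sdF-boolean d j = trans (sdF-binSum 0 d j)
    (trans (binSum-cong d (λ i → cong (λ z → osp z j) (ℕₚ.+-identityʳ i)))
           (trans (binSum-last d (λ i → osp i j)) (ℕₚ.+-comm _ (osp d j))))

  -- Restricted Eulerian polynomials and their symmetrizations.

  -- p d r (d ∸ r) is the restricted Eulerian polynomial of the permutations of d + 1
  -- letters starting with r + 1
  p : ℕ → ℕ → ℕ → ℕ → ℤ
  p d r e = hVec d (sdF r e)

  p-sucʳ : ∀ d r e k → p d r (suc e) k ≡ p d (suc r) e k + p d r e k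
  p-sucʳ d r e = hVec-+ d (sdF (suc r) e) (sdF r e)

  p-sucˡ : ∀ d r e → r ℕ.+ e ≤ d → ∀ k → p (suc d) r e k ≡ p d r e k - (p d r e ↑) k
  p-sucˡ d r e r+e≤d = hVec-suc d (sdF r e) (λ i d<i → sdF-zero r e (ℕₚ.≤-<-trans r+e≤d d<i))

  -- The Eulerian polynomial of d + 1 letters, as the h-polynomial of the subdivided boundary of the
  -- d-simplex: a chain of j nonempty proper faces is an ordered partition of d + 1 vertices into j
  -- + 1 blocks.
  euler : ℕ → ℕ → ℤ
  euler d = hVec d (λ j → osp (suc d) (suc j))

  -- Each step of the telescope splits off one factor 1 + t. What remains, `p d (suc d) 0`, counts
  -- the chains ending at the top and cancels. Only additivity of `hVec d` is used, so f-vectors of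
  -- degree d + 1 do no harm.
  euler-sum : ∀ d k → euler d k ≡ sumTo d (λ s → p d s (d ∸ s) k)
  euler-sum d k = +-cancelʳ (p d (suc d) 0 k) _ _
    (trans (sym top) (sym (subst (λ z → S d + p d (suc d) z k ≡ p d 0 (suc d) k) (ℕₚ.n∸n≡0 d)
      (telescope d ℕₚ.≤-refl))))
    where
    S : ℕ → ℤ
    S m = sumTo m (λ s → p d s (d ∸ s) k)
    telescope : ∀ m → m ≤ d → S m + p d (suc m) (d ∸ m) k ≡ p d 0 (suc d) k
    telescope zero    _ = trans (ℤₚ.+-comm (p d 0 d k) _) (sym (p-sucʳ d 0 d k))
    telescope (suc m) m<d = trans (ℤₚ.+-assoc (S m) _ _)
      (trans (cong (λ z → S m + z) (trans (ℤₚ.+-comm (p d (suc m) (d ∸ suc m) k) _)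
                (trans (sym (p-sucʳ d (suc m) (d ∸ suc m) k))
                       (cong (λ z → p d (suc m) z k) (sym (ℕₚ.+-∸-assoc 1 m<d))))))
             (telescope m (ℕₚ.<⇒≤ m<d)))
    top : p d 0 (suc d) k ≡ euler d k + p d (suc d) 0 k
    top = trans (hVec-cong d (sdF-boolean (suc d)) k)
      (trans (hVec-+ d (osp (suc d)) (λ j → osp (suc d) (suc j)) k)
             (ℤₚ.+-comm (hVec d (osp (suc d)) k) (euler d k)))

  -- Removing the top from the chains that end there shifts the f-vector, which is a factor t.
  p-last : ∀ d k → p (suc d) (suc d) 0 k ≡ (euler d ↑) k
  p-last d k = trans (hVec-cong (suc d) shift k) (hVec-shift d (λ j → osp (suc d) (suc j)) k)
    where
    shift : ∀ j → osp (suc d) j ≡ shiftℕ (λ j → osp (suc d) (suc j)) j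
    shift zero    = refl
    shift (suc j) = refl

  -- The subdivided simplex is a cone over its subdivided boundary, and coning preserves the
  -- h-polynomial: t E + (1-t) E = E.
  p-first : ∀ d k → p (suc d) 0 (suc d) k ≡ euler d k
  p-first d k = trans (hVec-cong (suc d) (sdF-boolean (suc d)) k)
    (trans (hVec-+ (suc d) (osp (suc d)) (λ j → osp (suc d) (suc j)) k)
    (trans (cong₂ _+_ (p-last d k)
              (hVec-suc d (λ j → osp (suc d) (suc j)) (λ i d<i → osp-zero (s≤s d<i)) k))
           (lem ((euler d ↑) k) (euler d k))))
    where
    lem : ∀ x y → x + (y + - x) ≡ y
    lem = solve-∀

  -- Reversing the coefficients exchanges p_{d,r} and p_{d,d-r}. So `q d r` is palindromic about d/2
  -- and `w d r` about (d+1)/2, which is why `w (suc d)` is expanded with d + 2 below.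
  q w : ℕ → ℕ → ℕ → ℤ
  q d r k = p d r (d ∸ r) k + p d (d ∸ r) r k
  w d r k = (p d r (d ∸ r) ↑) k + p d (d ∸ r) r k

  q-first : ∀ d k → q (suc d) 0 k ≡ euler d k + (euler d ↑) k
  q-first d k = cong₂ _+_ (p-first d k) (p-last d k)

  w-first : ∀ d k → w (suc d) 0 k ≡ (euler d ↑) k + (euler d ↑) k
  w-first d k = cong₂ _+_ (↑-cong (p-first d) k) (p-last d k)

  module _ (d r : ℕ) (r≤d : r ≤ d) where
    private
      e = d ∸ r
      A B A⁺ B⁺ C⁺ : ℕ → ℤ
      A = p d r e
      B = p d e r
      A⁺ = p (suc d) (suc r) e
      B⁺ = p (suc d) (suc e) r
      C⁺ = p (suc d) e r
      r+e≤d : r ℕ.+ e ≤ d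
      r+e≤d = ℕₚ.≤-reflexive (ℕₚ.m+[n∸m]≡n r≤d)
      e+r≤d : e ℕ.+ r ≤ d
      e+r≤d = ℕₚ.≤-reflexive (ℕₚ.m∸n+n≡m r≤d)
      1+d∸r : suc d ∸ r ≡ suc e
      1+d∸r = ℕₚ.+-∸-assoc 1 r≤d

      left : ∀ k → p (suc d) r (suc d ∸ r) k ≡ A⁺ k + (A k - (A ↑) k)
      left k = trans (cong (λ z → p (suc d) r z k) 1+d∸r)
        (trans (p-sucʳ (suc d) r e k) (cong (λ z → A⁺ k + z) (p-sucˡ d r e r+e≤d k)))

      right : ∀ k → p (suc d) e (suc r) k ≡ B⁺ k + (B k - (B ↑) k)
      right k = trans (p-sucʳ (suc d) e r k) (cong (λ z → B⁺ k + z) (p-sucˡ d e r e+r≤d k))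

      right′ : ∀ k → p (suc d) (suc d ∸ r) r k ≡ B⁺ k
      right′ k = cong (λ z → p (suc d) z r k) 1+d∸r

    -- Both `q`s in dimension d + 1 contain p_{d+1,r+1} and p_{d+1,d-r+1}. They differ by
    -- (1-t)(p_{d,d-r} - p_{d,r}) = 2 w - (1+t) q, and the negative part is put on the left, where
    -- it can be cancelled.
    q-suc : ∀ k → q (suc d) (suc r) k + (q d r k + (q d r ↑) k) ≡ q (suc d) r k + (w d r k + w d r k)
    q-suc k rewrite left k | right k | right′ k | ↑-+ A B k =
      lem (A k) (B k) ((A ↑) k) ((B ↑) k) (A⁺ k) (B⁺ k)
      where
      lem : ∀ a b a′ b′ x y → (x + (y + (b + - b′))) + ((a + b) + (a′ + b′))
          ≡ ((x + (a + - a′)) + y) + ((a′ + b) + (a′ + b))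
      lem = solve-∀

    -- Here the difference is (1-t)(p_{d,d-r} - t p_{d,r}) = (1+t) w - 2 t q.
    w-suc : ∀ k → w (suc d) (suc r) k + ((q d r ↑) k + (q d r ↑) k)
                ≡ w (suc d) r k + (w d r k + (w d r ↑) k)
    w-suc k rewrite ↑-cong left k | right k | right′ k | ↑-+ A B k | ↑-+ (A ↑) B k
                  | ↑-+ A⁺ (λ j → A j + - (A ↑) j) k | ↑-+ A (λ j → - (A ↑) j) k =
      trans (lem ((A ↑) k) (B k) ((A ↑ ↑) k) ((B ↑) k) ((A⁺ ↑) k) (B⁺ k))
            (cong (λ z → (A⁺ ↑) k + ((A ↑) k + z) + B⁺ k + ((A ↑) k + B k + ((A ↑ ↑) k + (B ↑) k))) (neg k))
      where
      neg : ∀ k → - (A ↑ ↑) k ≡ ((λ j → - (A ↑) j) ↑) k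
      neg zero    = refl
      neg (suc k) = refl
      lem : ∀ a b a′ b′ x y → (x + (y + (b + - b′))) + ((a + b′) + (a + b′))
          ≡ ((x + (a + - a′)) + y) + ((a + b) + (a′ + b′))
      lem = solve-∀

  -- Folding sums at the middle, and unrolling the recursions.

  -- for 2s = d the two summands of q d s belong to the same index and only one is kept
  q½ : ℕ → ℕ → ℕ → ℤ
  q½ d s k = if (s ℕ.+ s) ==ℕ d then p d s (d ∸ s) k else q d s k

  ==ℕ-refl : ∀ m → (m ==ℕ m) ≡ true
  ==ℕ-refl zero    = refl
  ==ℕ-refl (suc m) = ==ℕ-refl m

  ==ℕ-sound : ∀ {m l} → (m ==ℕ l) ≡ true → m ≡ l
  ==ℕ-sound {zero}  {zero}  _  = refl
  ==ℕ-sound {suc m} {suc l} eq = cong suc (==ℕ-sound eq)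

  ==ℕ-false : ∀ {m l} → m ≢ l → (m ==ℕ l) ≡ false
  ==ℕ-false {m} {l} m≢l with m ==ℕ l in eq
  ... | true  = ⊥-elim (m≢l (==ℕ-sound eq))
  ... | false = refl

  q½-off-middle : ∀ d s → s ℕ.+ s < d → ∀ k → q½ d s k ≡ q d s k
  q½-off-middle d s lt k rewrite ==ℕ-false (ℕₚ.<⇒≢ lt) = refl

  q-middle : ∀ d s → s ℕ.+ s ≡ d → ∀ k → q d s k ≡ q½ d s k + q½ d s k
  q-middle _ s refl k rewrite ==ℕ-refl (s ℕ.+ s) | ℕₚ.m+n∸n≡m s s = refl

  fold : ∀ d (a : ℕ → ℤ) →
    sumTo d a ≡ sumTo ⌊ d /2⌋ (λ s → if (s ℕ.+ s) ==ℕ d then a s else a s + a (d ∸ s))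
  fold zero          a = refl
  fold (suc zero)    a = refl
  fold (suc (suc d)) a = begin
    sumTo (suc d) a + a (suc (suc d))
      ≡⟨ cong (_+ a (suc (suc d))) (sumTo-head d a) ⟩
    (a 0 + sumTo d (a ∘ suc)) + a (suc (suc d))
      ≡⟨ lem (a 0) (sumTo d (a ∘ suc)) (a (suc (suc d))) ⟩
    (a 0 + a (suc (suc d))) + sumTo d (a ∘ suc)
      ≡⟨ cong (λ z → a 0 + a (suc (suc d)) + z) (trans (fold d (a ∘ suc)) (sumTo-cong ⌊ d /2⌋ term)) ⟩
    (a 0 + a (suc (suc d))) + sumTo ⌊ d /2⌋ (F ∘ suc)
      ≡⟨ sumTo-head ⌊ d /2⌋ F ⟨
    sumTo (suc ⌊ d /2⌋) F ∎
    where
    open ≡-Reasoning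
    F : ℕ → ℤ
    F s = if (s ℕ.+ s) ==ℕ suc (suc d) then a s else a s + a (suc (suc d) ∸ s)
    lem : ∀ x y z → (x + y) + z ≡ (x + z) + y
    lem = solve-∀
    term : ∀ s → s ≤ ⌊ d /2⌋ →
      (if (s ℕ.+ s) ==ℕ d then a (suc s) else a (suc s) + a (suc (d ∸ s))) ≡ F (suc s)
    term s s≤ rewrite ℕₚ.+-suc s s
                    | ℕₚ.+-∸-assoc 1 (ℕₚ.≤-trans s≤ (ℕₚ.⌊n/2⌋≤n d)) = refl

  fold-symmetric : ∀ d (c : ℕ → ℤ) → Symmetric d c → ∀ k →
    sumTo d (λ s → c s * p d s (d ∸ s) k) ≡ sumTo ⌊ d /2⌋ (λ s → c s * q½ d s k)
  fold-symmetric d c c-sym k = trans (fold d _) (sumTo-cong ⌊ d /2⌋ term)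
    where
    term : ∀ s → s ≤ ⌊ d /2⌋ →
      (if (s ℕ.+ s) ==ℕ d then c s * p d s (d ∸ s) k
         else c s * p d s (d ∸ s) k + c (d ∸ s) * p d (d ∸ s) (d ∸ (d ∸ s)) k) ≡ c s * q½ d s k
    term s s≤ with (s ℕ.+ s) ==ℕ d | ℕₚ.≤-trans s≤ (ℕₚ.⌊n/2⌋≤n d)
    ... | true  | _   = refl
    ... | false | s≤d rewrite sym (c-sym s s≤d) | ℕₚ.m∸[m∸n]≡n s≤d =
      sym (ℤₚ.*-distribˡ-+ (c s) (p d s (d ∸ s) k) (p d (d ∸ s) s k))

  euler-fold : ∀ d k → euler d k ≡ sumTo ⌊ d /2⌋ (λ s → q½ d s k)
  euler-fold d k = trans (euler-sum d k)
    (trans (sumTo-cong d (λ s _ → sym (ℤₚ.*-identityˡ (p d s (d ∸ s) k))))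
    (trans (fold-symmetric d (λ _ → + 1) (λ _ _ → refl) k)
           (sumTo-cong ⌊ d /2⌋ (λ s _ → ℤₚ.*-identityˡ (q½ d s k)))))

  -- The sum over r ≤ s < m. Smaller indices are masked instead of dropped, in accordance with
  -- `attach`, whose vertex set must not depend on r.
  tailSum : ℕ → (ℕ → ℤ) → ℕ → ℤ
  tailSum zero    ν r = + 0
  tailSum (suc m) ν r = tailSum m ν r + (if r ≤ᵇ m then ν m else + 0)

  ≤ᵇ-true : ∀ {r m} → r ≤ m → (r ≤ᵇ m) ≡ true
  ≤ᵇ-true {r} {m} r≤m with r ≤ᵇ m | ℕₚ.≤⇒≤ᵇ r≤m
  ... | true | _ = refl

  ≤ᵇ-false : ∀ {r m} → m < r → (r ≤ᵇ m) ≡ false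
  ≤ᵇ-false {r} {m} m<r with r ≤ᵇ m in eq
  ... | false = refl
  ... | true  = ⊥-elim (ℕₚ.<⇒≱ m<r (ℕₚ.≤ᵇ⇒≤ r m (subst T (sym eq) tt)))

  tailSum-empty : ∀ m ν r → m ≤ r → tailSum m ν r ≡ + 0
  tailSum-empty zero    ν r m≤r = refl
  tailSum-empty (suc m) ν r m<r
    rewrite tailSum-empty m ν r (ℕₚ.<⇒≤ m<r) | ≤ᵇ-false m<r = refl

  tailSum-suc : ∀ m ν r → r < m → tailSum m ν r ≡ ν r + tailSum m ν (suc r)
  tailSum-suc (suc m) ν r (s≤s r≤m) with r ℕₚ.≟ m
  ... | yes refl rewrite tailSum-empty r ν r ℕₚ.≤-refl | ≤ᵇ-true (ℕₚ.≤-refl {r})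
                       | ≤ᵇ-false (ℕₚ.n<1+n r) | tailSum-empty r ν (suc r) (ℕₚ.n≤1+n r) =
    trans (ℤₚ.+-identityˡ (ν r)) (sym (ℤₚ.+-identityʳ (ν r)))
  ... | no r≢m rewrite ≤ᵇ-true r≤m | ≤ᵇ-true (ℕₚ.≤∧≢⇒< r≤m r≢m)
                     | tailSum-suc m ν r (ℕₚ.≤∧≢⇒< r≤m r≢m) = ℤₚ.+-assoc (ν r) _ (ν m)

  tailSum-all : ∀ m (ν : ℕ → ℤ) → sumTo m ν ≡ ν 0 + tailSum m (ν ∘ suc) 0
  tailSum-all zero    ν = sym (ℤₚ.+-identityʳ (ν 0))
  tailSum-all (suc m) ν = trans (cong (_+ ν (suc m)) (tailSum-all m ν)) (ℤₚ.+-assoc (ν 0) _ (ν (suc m)))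

  headSum : ℕ → (ℕ → ℤ) → ℤ
  headSum zero    ν = + 0
  headSum (suc r) ν = headSum r ν + ν r

  module _ (d : ℕ) where
    private
      D m : ℕ
      D = suc d
      m = ⌊ D /2⌋

    -- Because of the shift of index, `tail r` runs over r < s ≤ m and `acc r` over 1 ≤ s ≤ r. The
    -- index 0 stays apart, since both unrollings treat it differently.
    tail acc : ℕ → ℕ → ℤ
    tail r k = tailSum m (λ s → q½ D (suc s) k) r
    acc r k = headSum r (λ s → w D (suc s) k)

    private
      suc≤m : ∀ {r} → suc r ℕ.+ suc r ≤ D → r < m
      suc≤m le = i+i≤n⇒i≤⌊n/2⌋ D le
      tail-suc : ∀ r → suc r ℕ.+ suc r ≤ D → ∀ k → tail r k ≡ q½ D (suc r) k + tail (suc r) k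
      tail-suc r le k = tailSum-suc m (λ s → q½ D (suc s) k) r (suc≤m le)
      euler-tail : ∀ k → euler D k ≡ q D 0 k + tail 0 k
      euler-tail k = trans (euler-fold D k) (tailSum-all m (λ s → q½ D s k))
      2r≤ : ∀ r → suc (suc r) ℕ.+ suc (suc r) ≤ suc D → suc r ℕ.+ suc r < D
      2r≤ r (s≤s le) = subst (_≤ D) (ℕₚ.+-suc (suc r) (suc r)) le
      r≤D : ∀ r → suc r ℕ.+ suc r < D → suc r ≤ D
      r≤D r lt = ℕₚ.≤-trans (ℕₚ.m≤m+n (suc r) (suc r)) (ℕₚ.<⇒≤ lt)

    -- The start q_{D+1,0} = (1+t) euler_D contains every (1+t) q_{D,s}. The step from r to r + 1
    -- takes away the one for s = r and adds 2 w_{D,r}. The bound keeps the removed indices below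
    -- the middle, where `q½` agrees with `q`.
    q-unroll : ∀ r → suc r ℕ.+ suc r ≤ suc D → ∀ k →
      q (suc D) (suc r) k ≡ ((w D 0 k + w D 0 k) + (acc r k + acc r k)) + (tail r k + (tail r ↑) k)
    q-unroll zero le k = +-cancelʳ (q D 0 k + (q D 0 ↑) k) _ _
      (trans (q-suc D 0 z≤n k) (trans (cong (_+ (w D 0 k + w D 0 k)) first)
        (lem (w D 0 k) (q D 0 k) (tail 0 k) ((q D 0 ↑) k) ((tail 0 ↑) k))))
      where
      first : q (suc D) 0 k ≡ (q D 0 k + tail 0 k) + ((q D 0 ↑) k + (tail 0 ↑) k)
      first = trans (q-first D k) (cong₂ _+_ (euler-tail k)
        (trans (↑-cong euler-tail k) (↑-+ (q D 0) (tail 0) k)))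
      lem : ∀ w q t q′ t′ → ((q + t) + (q′ + t′)) + (w + w)
          ≡ (((w + w) + (+ 0 + + 0)) + (t + t′)) + (q + q′)
      lem = solve-∀
    q-unroll (suc r) le k = +-cancelʳ (q D (suc r) k + (q D (suc r) ↑) k) _ _
      (trans (q-suc D (suc r) (r≤D r lt) k)
      (trans (cong (_+ (w D (suc r) k + w D (suc r) k)) (q-unroll r (ℕₚ.≤-trans (ℕₚ.<⇒≤ lt) (ℕₚ.n≤1+n D)) k))
      (trans (cong₂ (λ x y → (((w D 0 k + w D 0 k) + (acc r k + acc r k)) + (x + y)) + (w D (suc r) k + w D (suc r) k))
                (step k) (trans (↑-cong step k) (↑-+ (q D (suc r)) (tail (suc r)) k)))
        (lem (w D 0 k) (w D (suc r) k) (acc r k) (q D (suc r) k) ((q D (suc r) ↑) k) (tail (suc r) k) ((tail (suc r) ↑) k)))))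
      where
      lt : suc r ℕ.+ suc r < D
      lt = 2r≤ r le
      step : ∀ k → tail r k ≡ q D (suc r) k + tail (suc r) k
      step k = trans (tail-suc r (ℕₚ.<⇒≤ lt) k) (cong (_+ tail (suc r) k) (q½-off-middle D (suc r) lt k))
      lem : ∀ w₀ v a x x′ t t′ →
        (((w₀ + w₀) + (a + a)) + ((x + t) + (x′ + t′))) + (v + v)
          ≡ (((w₀ + w₀) + ((a + v) + (a + v))) + (t + t′)) + (x + x′)
      lem = solve-∀

    -- From the start 2 t euler_D, the step at r takes away 2 t q_{D,r} and adds (1+t) w_{D,r}. At r
    -- = 0 these cancel, as (1+t) w_{D,0} = 2 t (1+t) euler_d = 2 t q_{D,0}; so `q D 0` survives and
    -- `acc` begins at 1.
    w-unroll : ∀ r → suc r ℕ.+ suc r ≤ suc D → ∀ k →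
      w (suc D) (suc r) k ≡ (((q D 0 ↑) k + (tail r ↑) k) + ((q D 0 ↑) k + (tail r ↑) k)) + (acc r k + (acc r ↑) k)
    w-unroll zero le k = +-cancelʳ ((q D 0 ↑) k + (q D 0 ↑) k) _ _
      (trans (w-suc D 0 z≤n k) (trans (cong₂ _+_ first (cong₂ _+_ (w-first d k) (trans (↑-cong (w-first d) k) (↑-+ (euler d ↑) (euler d ↑) k))))
        (trans (lem ((q D 0 ↑) k) ((tail 0 ↑) k) ((euler d ↑) k) ((euler d ↑ ↑) k))
          (cong₂ (λ x y → (((q D 0 ↑) k + (tail 0 ↑) k) + ((q D 0 ↑) k + (tail 0 ↑) k) + (+ 0 + x)) + (y + y))
             (zero↑ k) (sym (trans (↑-cong (q-first d) k) (↑-+ (euler d) (euler d ↑) k)))))))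
      where
      first : w (suc D) 0 k ≡ ((q D 0 ↑) k + (tail 0 ↑) k) + ((q D 0 ↑) k + (tail 0 ↑) k)
      first = trans (w-first D k) (cong₂ _+_ e e)
        where
        e : (euler D ↑) k ≡ (q D 0 ↑) k + (tail 0 ↑) k
        e = trans (↑-cong euler-tail k) (↑-+ (q D 0) (tail 0) k)
      zero↑ : ∀ k → + 0 ≡ (acc 0 ↑) k
      zero↑ zero    = refl
      zero↑ (suc k) = refl
      lem : ∀ q t a a′ → ((q + t) + (q + t)) + ((a + a) + (a′ + a′))
          ≡ (((q + t) + (q + t)) + (+ 0 + + 0)) + ((a + a′) + (a + a′))
      lem = solve-∀
    w-unroll (suc r) le k = +-cancelʳ ((q D (suc r) ↑) k + (q D (suc r) ↑) k) _ _
      (trans (w-suc D (suc r) (r≤D r lt) k)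
      (trans (cong (_+ (w D (suc r) k + (w D (suc r) ↑) k)) (w-unroll r (ℕₚ.≤-trans (ℕₚ.<⇒≤ lt) (ℕₚ.n≤1+n D)) k))
      (trans (cong (λ y → ((((q D 0 ↑) k + y) + ((q D 0 ↑) k + y)) + (acc r k + (acc r ↑) k)) + (w D (suc r) k + (w D (suc r) ↑) k))
                (trans (↑-cong step k) (↑-+ (q D (suc r)) (tail (suc r)) k)))
      (trans (lem ((q D 0 ↑) k) (w D (suc r) k) ((w D (suc r) ↑) k) (acc r k) ((acc r ↑) k) ((q D (suc r) ↑) k) ((tail (suc r) ↑) k))
        (cong (λ z → ((((q D 0 ↑) k + (tail (suc r) ↑) k) + ((q D 0 ↑) k + (tail (suc r) ↑) k)) + (acc (suc r) k + z)) + ((q D (suc r) ↑) k + (q D (suc r) ↑) k))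
          (sym (↑-+ (acc r) (w D (suc r)) k)))))))
      where
      lt : suc r ℕ.+ suc r < D
      lt = 2r≤ r le
      step : ∀ k → tail r k ≡ q D (suc r) k + tail (suc r) k
      step k = trans (tail-suc r (ℕₚ.<⇒≤ lt) k) (cong (_+ tail (suc r) k) (q½-off-middle D (suc r) lt k))
      lem : ∀ q₀ v v′ a a′ x t →
        (((q₀ + (x + t)) + (q₀ + (x + t))) + (a + a′)) + (v + v′)
          ≡ (((q₀ + t) + (q₀ + t)) + ((a + v) + (a′ + v′))) + (x + x)
      lem = solve-∀

    -- At the middle index the tail is empty, so the right side of `q-unroll` is visibly twice a sum
    -- and can be halved.
    q½-middle : ∀ r → suc r ℕ.+ suc r ≡ suc D → ∀ k → q½ (suc D) (suc r) k ≡ w D 0 k + acc r k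
    q½-middle r eq k = ℤₚ.*-cancelˡ-≡ (+ 2) _ _
      (trans (two (q½ (suc D) (suc r) k))
      (trans (sym (q-middle (suc D) (suc r) eq k))
      (trans (q-unroll r (ℕₚ.≤-reflexive eq) k)
      (trans (cong₂ (λ x y → ((w D 0 k + w D 0 k) + (acc r k + acc r k)) + (x + y)) (empty k)
               (trans (↑-cong empty k) (zero↑ k)))
             (lem (w D 0 k) (acc r k))))))
      where
      two : ∀ x → + 2 * x ≡ x + x
      two = solve-∀
      lem : ∀ x y → ((x + x) + (y + y)) + (+ 0 + + 0) ≡ + 2 * (x + y)
      lem = solve-∀
      zero↑ : ∀ k → ((λ _ → + 0) ↑) k ≡ + 0
      zero↑ zero    = refl
      zero↑ (suc k) = refl
      m≤r : m ≤ r
      m≤r = ℕₚ.≤-reflexive (trans (cong ⌊_/2⌋ (trans (sym (ℕₚ.suc-injective eq)) (ℕₚ.+-suc r r)))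
                                  (half r))
        where
        half : ∀ r → ⌊ suc (r ℕ.+ r) /2⌋ ≡ r
        half zero    = refl
        half (suc r) rewrite ℕₚ.+-suc r r = cong suc (half r)
      empty : ∀ k → tail r k ≡ + 0
      empty k = tailSum-empty m (λ s → q½ D (suc s) k) r m≤r

  -- The h-vector of a subdivision in terms of the h-vector.

  sumTo-last : ∀ m {f : ℕ → ℤ} → (∀ i → i < m → f i ≡ + 0) → sumTo m f ≡ f m
  sumTo-last zero    f≈0 = refl
  sumTo-last (suc m) {f} f≈0 = trans
    (cong (_+ f (suc m)) (sumTo-zero m (λ i i≤m → f≈0 i (s≤s i≤m)))) (ℤₚ.+-identityˡ (f (suc m)))

  sumTo-↑ : ∀ m (c : ℕ → ℤ) (f : ℕ → ℕ → ℤ) k →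
    ((λ j → sumTo m (λ r → c r * f r j)) ↑) k ≡ sumTo m (λ r → c r * (f r ↑) k)
  sumTo-↑ m c f zero    = sym (sumTo-zero m (λ r _ → ℤₚ.*-zeroʳ (c r)))
  sumTo-↑ m c f (suc k) = refl

  δ : ℕ → ℕ → ℕ
  δ i j = 𝟙 (i ==ℕ j)

  δ-≢ : ∀ {i j} → i ≢ j → δ i j ≡ 0
  δ-≢ i≢j = cong 𝟙 (==ℕ-false i≢j)

  -- Brenti and Welker's formula, for a single face of rank i
  hVec-osp : ∀ e i k → hVec (e ℕ.+ i) (osp i) k
    ≡ sumTo (e ℕ.+ i) (λ r → hVec (e ℕ.+ i) (δ i) r * p (e ℕ.+ i) r (e ℕ.+ i ∸ r) k)
  -- In dimension i the f-polynomial t^i has h-polynomial t^i, so only r = i contributes.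
  hVec-osp zero i k = sym (trans (sumTo-last i low) (trans (cong₂ _*_ top (cong (λ z → p i i z k) (ℕₚ.n∸n≡0 i)))
                                                            (ℤₚ.*-identityˡ (p i i 0 k))))
    where
    off : ∀ r j → j ≢ i → sgn (r ∸ j) * + ((i ∸ j) C (r ∸ j)) * + δ i j ≡ + 0
    off r j j≢i rewrite δ-≢ (λ e → j≢i (sym e)) = ℤₚ.*-zeroʳ (sgn (r ∸ j) * + ((i ∸ j) C (r ∸ j)))
    low : ∀ r → r < i → hVec i (δ i) r * p i r (i ∸ r) k ≡ + 0
    low r r<i = trans (cong (_* p i r (i ∸ r) k)
      (sumTo-zero r (λ j j≤r → off r j (ℕₚ.<⇒≢ (ℕₚ.≤-<-trans j≤r r<i))))) (ℤₚ.*-zeroˡ (p i r (i ∸ r) k))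
    top : hVec i (δ i) i ≡ + 1
    top = trans (sumTo-last i (λ j j<i → off i j (ℕₚ.<⇒≢ j<i))) final
      where
      final : sgn (i ∸ i) * + ((i ∸ i) C (i ∸ i)) * + δ i i ≡ + 1
      final rewrite ℕₚ.n∸n≡0 i | ==ℕ-refl i = refl
  hVec-osp (suc e) i k = begin
    hVec (suc d) (osp i) k
      ≡⟨ hVec-suc d (osp i) (λ j d<j → osp-zero (ℕₚ.≤-<-trans (ℕₚ.m≤n+m i e) d<j)) k ⟩
    hVec d (osp i) k - (hVec d (osp i) ↑) k
      ≡⟨ cong₂ (λ x y → x - y) (hVec-osp e i k) (trans (↑-cong (hVec-osp e i) k) (sumTo-↑ d c P k)) ⟩
    sumTo d (λ r → c r * P r k) - sumTo d (λ r → c r * (P r ↑) k)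
      ≡⟨ cong (λ z → sumTo d (λ r → c r * P r k) + z) (sumTo-neg d _) ⟨
    sumTo d (λ r → c r * P r k) + sumTo d (λ r → - (c r * (P r ↑) k))
      ≡⟨ sumTo-+ d _ _ ⟨
    sumTo d (λ r → c r * P r k + - (c r * (P r ↑) k))
      -- (1-t) p_{d,r} = p_{d+1,r} - p_{d+1,r+1}.
      ≡⟨ sumTo-cong d term ⟩
    sumTo d (λ r → c r * (b r - b (suc r)))
      -- The boundary term for `abel` is zero, as the h-polynomial `c` has degree at most d.
      ≡⟨ trans (sym (ℤₚ.+-identityʳ _))
               (cong (λ z → sumTo d (λ r → c r * (b r - b (suc r))) + z) (sym (trans (cong (_* b (suc d)) c-high) (ℤₚ.*-zeroˡ (b (suc d)))))) ⟩
    sumTo d (λ r → c r * (b r - b (suc r))) + c (suc d) * b (suc d)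
      ≡⟨ abel d c b ⟩
    sumTo (suc d) (λ r → (c r - (c ↑) r) * b r)
      ≡⟨ sumTo-cong (suc d) (λ r _ → cong (_* b r) (sym (hVec-suc d (δ i) δ-high r))) ⟩
    sumTo (suc d) (λ r → hVec (suc d) (δ i) r * b r) ∎
    where
    open ≡-Reasoning
    d = e ℕ.+ i
    c : ℕ → ℤ
    c = hVec d (δ i)
    P : ℕ → ℕ → ℤ
    P r = p d r (d ∸ r)
    b : ℕ → ℤ
    b r = p (suc d) r (suc d ∸ r) k
    δ-high : ∀ j → d < j → δ i j ≡ 0
    δ-high j d<j = δ-≢ (ℕₚ.<⇒≢ (ℕₚ.≤-<-trans (ℕₚ.m≤n+m i e) d<j))
    c-high : c (suc d) ≡ + 0
    c-high = sumTo-zero (suc d) zeroTerm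
      where
      zeroTerm : ∀ j → j ≤ suc d → sgn (suc d ∸ j) * + ((d ∸ j) C (suc d ∸ j)) * + δ i j ≡ + 0
      zeroTerm j j≤ with j ℕₚ.≤? d
      ... | yes j≤d rewrite ℕₚ.+-∸-assoc 1 j≤d | k>n⇒nCk≡0 (ℕₚ.n<1+n (d ∸ j))
                          | ℤₚ.*-zeroʳ (sgn (suc (d ∸ j))) = ℤₚ.*-zeroˡ (+ δ i j)
      ... | no j≰d rewrite δ-high j (ℕₚ.≰⇒> j≰d) = ℤₚ.*-zeroʳ (sgn (suc d ∸ j) * + ((d ∸ j) C (suc d ∸ j)))
    term : ∀ r → r ≤ d → c r * P r k + - (c r * (P r ↑) k) ≡ c r * (b r - b (suc r))
    term r r≤d = trans (factor (c r) (P r k) ((P r ↑) k)) (cong (c r *_) (sym diff))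
      where
      factor : ∀ c x y → c * x + - (c * y) ≡ c * (x + - y)
      factor = solve-∀
      cancel : ∀ x y → (x + y) + - x ≡ y
      cancel = solve-∀
      diff : b r - b (suc r) ≡ P r k - (P r ↑) k
      diff = trans (cong (λ z → p (suc d) r z k - b (suc r)) (ℕₚ.+-∸-assoc 1 r≤d))
        (trans (cong (_- b (suc r)) (p-sucʳ (suc d) r (d ∸ r) k))
        (trans (cancel (b (suc r)) (p (suc d) r (d ∸ r) k))
               (p-sucˡ d r (d ∸ r) (ℕₚ.≤-reflexive (ℕₚ.m+[n∸m]≡n r≤d)) k)))

  -- Both sides are additive in the list of faces, so a single face suffices.
  hVec-sd : {A : Set} (d : ℕ) (rank : A → ℕ) (xs : List A) → All (λ F → rank F ≤ d) xs → ∀ k →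
    hVec d (λ j → ∑ (λ F → osp (rank F) j) xs) k
      ≡ sumTo d (λ r → hVec d (λ i → count (λ F → rank F ==ℕ i) xs) r * p d r (d ∸ r) k)
  hVec-sd d rank [] [] k = trans (hVec-zero d k)
    (sym (sumTo-zero d (λ r _ → trans (cong (_* p d r (d ∸ r) k) (hVec-zero d r)) (ℤₚ.*-zeroˡ (p d r (d ∸ r) k)))))
  hVec-sd d rank (F ∷ xs) (r≤d ∷ rs) k = begin
    hVec d (λ j → osp (rank F) j ℕ.+ ∑ (λ F → osp (rank F) j) xs) k
      ≡⟨ hVec-+ d (osp (rank F)) _ k ⟩
    hVec d (osp (rank F)) k + hVec d (λ j → ∑ (λ F → osp (rank F) j) xs) k
      ≡⟨ cong₂ _+_ single (hVec-sd d rank xs rs k) ⟩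
    sumTo d (λ r → hVec d (δ (rank F)) r * P r) + sumTo d (λ r → hVec d cnt r * P r)
      ≡⟨ sumTo-+ d _ _ ⟨
    sumTo d (λ r → hVec d (δ (rank F)) r * P r + hVec d cnt r * P r)
      ≡⟨ sumTo-cong d (λ r _ → trans (sym (ℤₚ.*-distribʳ-+ (P r) (hVec d (δ (rank F)) r) (hVec d cnt r)))
           (cong (_* P r) (trans (sym (hVec-+ d (δ (rank F)) cnt r)) (hVec-cong d split r)))) ⟩
    sumTo d (λ r → hVec d (λ i → count (λ F → rank F ==ℕ i) (F ∷ xs)) r * P r) ∎
    where
    open ≡-Reasoning
    P : ℕ → ℤ
    P r = p d r (d ∸ r) k
    cnt : ℕ → ℕ
    cnt i = count (λ F → rank F ==ℕ i) xs
    single : hVec d (osp (rank F)) k ≡ sumTo d (λ r → hVec d (δ (rank F)) r * P r)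
    single = subst (λ d → hVec d (osp (rank F)) k ≡ sumTo d (λ r → hVec d (δ (rank F)) r * p d r (d ∸ r) k))
      (ℕₚ.m∸n+n≡m r≤d) (hVec-osp (d ∸ rank F) (rank F) k)
    split : ∀ i → δ (rank F) i ℕ.+ cnt i ≡ count (λ F → rank F ==ℕ i) (F ∷ xs)
    split i with rank F ==ℕ i
    ... | true  = refl
    ... | false = refl

open Polynomials

-- Boolean intervals, and the f-vector and dimension of the barycentric subdivision.

module FacePoset where
  open import Data.Nat.Base using (_+_; _*_; _^_)
  import Data.Bool.Properties as Boolₚ
  open import Data.Fin.Base using (Fin; zero; suc)
  open import Data.Fin.Properties using (_≟_)
  open import Data.Fin.Subset using (Subset; ∣_∣; _⊆_) renaming (⊥ to ∅)
  open import Data.Vec.Base using ([]; _∷_; lookup; _[_]≔_)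
  import Data.Vec.Properties as Vecₚ
  import Data.Fin.Subset.Properties as Subₚ
  open import Data.List.Membership.Propositional using (_∈_)
  open import Data.List.Membership.Propositional.Properties using (∈-allFin)
  open import Data.List.Relation.Unary.Any using (here; there)
  open import Axiom.UniquenessOfIdentityProofs using (module Decidable⇒UIP)
  open import Function.Bundles using (Equivalence)
  open import Relation.Nullary.Decidable.Core using (isYes)

  ∑-binSum : ∀ r (a : ℕ → ℕ) → ∑ (λ τ → a ∣ τ ∣) (allSubsets r) ≡ binSum r a
  ∑-binSum zero    a = ℕₚ.+-identityʳ (a 0)
  ∑-binSum (suc r) a = trans (∑-allSubsets {r} (λ τ → a ∣ τ ∣)) (cong₂ _+_ (∑-binSum r (a ∘ suc)) (∑-binSum r a))

  module Poset (Δ : BooleanCellComplex) where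
    open BooleanCellComplex Δ renaming (n to N)

    faces : List (Fin N)
    faces = allFin N

    module Interval (F : Fin N) where
      r : ℕ
      r = rank F
      φ = proj₁ (boolean F)
      φ-inj = proj₁ (proj₁ (proj₂ (boolean F)))
      φ-sur = proj₂ (proj₁ (proj₂ (boolean F)))
      φ-mono = proj₂ (proj₂ (boolean F))

      ψ⁺ : Subset r → Σ (Fin N) (λ G → G ≼ F ≡ true)
      ψ⁺ τ = proj₁ (φ-sur τ)

      ψ : Subset r → Fin N
      ψ τ = proj₁ (ψ⁺ τ)

      φ∘ψ⁺ : ∀ τ → φ (ψ⁺ τ) ≡ τ
      φ∘ψ⁺ τ = proj₂ (φ-sur τ) refl

      ψ-injective : ∀ {σ τ} → ψ σ ≡ ψ τ → σ ≡ τ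
      ψ-injective {σ} {τ} eq = trans (sym (φ∘ψ⁺ σ)) (trans (cong φ lem) (φ∘ψ⁺ τ))
        where
        -- Proofs of `G ≼ F ≡ true` are unique, so a member of the interval is determined by its
        -- face.
        pair≡ : (a b : Σ (Fin N) (λ G → G ≼ F ≡ true)) → proj₁ a ≡ proj₁ b → a ≡ b
        pair≡ (G , u) (_ , v) refl = cong (G ,_) (Decidable⇒UIP.≡-irrelevant Boolₚ._≟_ u v)
        lem : ψ⁺ σ ≡ ψ⁺ τ
        lem = pair≡ (ψ⁺ σ) (ψ⁺ τ) eq

      ψ-onto : ∀ {G} → G ≼ F ≡ true → ∃ λ τ → ψ τ ≡ G
      ψ-onto {G} G≼F = φ (G , G≼F) , cong proj₁ (φ-inj (φ∘ψ⁺ (φ (G , G≼F))))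

      ψ-⊆ : ∀ {σ τ} → ψ σ ≼ ψ τ ≡ true → σ ⊆ τ
      ψ-⊆ {σ} {τ} le = subst₂ (λ a b → a ⊆ b) (φ∘ψ⁺ σ) (φ∘ψ⁺ τ) (Equivalence.to (φ-mono (ψ⁺ σ) (ψ⁺ τ)) le)

      ⊆-ψ : ∀ {σ τ} → σ ⊆ τ → ψ σ ≼ ψ τ ≡ true
      ⊆-ψ {σ} {τ} σ⊆τ = Equivalence.from (φ-mono (ψ⁺ σ) (ψ⁺ τ))
        (subst₂ (λ a b → a ⊆ b) (sym (φ∘ψ⁺ σ)) (sym (φ∘ψ⁺ τ)) σ⊆τ)

      -- The indicator of G ≼ F is the number of subsets that ψ sends to G; with this the two sums
      -- can be exchanged and no list has to be permuted.
      ∑-reindex : (g : Fin N → ℕ) → ∑ (λ G → 𝟙 (G ≼ F) * g G) faces ≡ ∑ (g ∘ ψ) (allSubsets r)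
      ∑-reindex g = begin
        ∑ (λ G → 𝟙 (G ≼ F) * g G) faces
          ≡⟨ ∑-cong faces (λ G → cong (_* g G) (fibre G)) ⟩
        ∑ (λ G → ∑ (λ τ → 𝟙 (isYes (ψ τ ≟ G))) (allSubsets r) * g G) faces
          ≡⟨ ∑-cong faces (λ G → trans (ℕₚ.*-comm _ (g G)) (trans (sym (∑-*ˡ (g G) _ (allSubsets r)))
               (∑-cong (allSubsets r) (λ τ → ℕₚ.*-comm (g G) _)))) ⟩
        ∑ (λ G → ∑ (λ τ → 𝟙 (isYes (ψ τ ≟ G)) * g G) (allSubsets r)) faces
          ≡⟨ ∑-swap _ faces (allSubsets r) ⟩
        ∑ (λ τ → ∑ (λ G → 𝟙 (isYes (ψ τ ≟ G)) * g G) faces) (allSubsets r)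
          ≡⟨ ∑-cong (allSubsets r) (λ τ → ∑-select (ψ τ) g) ⟩
        ∑ (g ∘ ψ) (allSubsets r) ∎
        where
        open ≡-Reasoning
        fibre : ∀ G → 𝟙 (G ≼ F) ≡ ∑ (λ τ → 𝟙 (isYes (ψ τ ≟ G))) (allSubsets r)
        fibre G with G ≼ F in eq
        ... | true  with ψ-onto eq
        ...   | τ , refl = sym (∑-uniqueSubset (λ τ′ → isYes (ψ τ′ ≟ ψ τ)) τ (isYes-refl (ψ τ))
                                  (λ τ′ e → sym (ψ-injective (isYes-sound e))))
        fibre G | false = sym (∑-zero (allSubsets r) (λ τ → cong 𝟙 (isYes-≢
          (λ { refl → absurdᵇ eq (proj₂ (ψ⁺ τ)) }))))

    ∑-below : ∀ G → ∑ (λ H → 𝟙 (H ≼ G)) faces ≡ 2 ^ rank G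
    ∑-below G = trans (∑-cong faces (λ H → sym (ℕₚ.*-identityʳ _)))
      (trans (∑-reindex (λ _ → 1)) (const-one (rank G)))
      where
      open Interval G
      const-one : ∀ r → ∑ (λ _ → 1) (allSubsets r) ≡ 2 ^ r
      const-one zero    = refl
      const-one (suc r) = trans (∑-allSubsets {r} (λ _ → 1))
        (cong₂ _+_ (const-one r) (trans (const-one r) (sym (ℕₚ.+-identityʳ _))))

    -- The interval below ψ τ has 2 ^ rank (ψ τ) members by its own boolean structure and 2 ^ ∣ τ ∣
    -- by that of F. This counting is what relates the ranks of different faces.
    rank-ψ : ∀ F τ → rank (Interval.ψ F τ) ≡ ∣ τ ∣
    rank-ψ F τ = 2^-injective (rank (ψ τ)) ∣ τ ∣ (begin
      2 ^ rank (ψ τ)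
        ≡⟨ ∑-below (ψ τ) ⟨
      ∑ (λ H → 𝟙 (H ≼ ψ τ)) faces
        ≡⟨ ∑-cong faces (λ H → trans (cong 𝟙 (bool-iff
             (λ e → true-∧ (≼-trans H (ψ τ) F e (proj₂ (ψ⁺ τ))) e)
             (λ e → proj₂ (∧-true {H ≼ F} e)))) (𝟙-∧ (H ≼ F) (H ≼ ψ τ))) ⟩
      ∑ (λ H → 𝟙 (H ≼ F) * 𝟙 (H ≼ ψ τ)) faces
        ≡⟨ ∑-reindex (λ H → 𝟙 (H ≼ ψ τ)) ⟩
      ∑ (λ σ → 𝟙 (ψ σ ≼ ψ τ)) (allSubsets r)
        ≡⟨ ∑-power τ (λ σ → ψ σ ≼ ψ τ) (λ σ → ψ-⊆) (λ σ → ⊆-ψ) ⟩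
      2 ^ ∣ τ ∣ ∎)
      where
      open ≡-Reasoning
      open Interval F

    infix 4 _≺_
    _≺_ : Fin N → Fin N → Bool
    H ≺ G = (H ≼ G) ∧ not (isYes (H ≟ G))

    ≺⇒≼ : ∀ {H G} → (H ≺ G) ≡ true → H ≼ G ≡ true
    ≺⇒≼ {H} {G} e = proj₁ (∧-true {H ≼ G} e)

    ≺-irrefl : ∀ {H} → (H ≺ H) ≡ false
    ≺-irrefl {H} rewrite isYes-refl H = Boolₚ.∧-zeroʳ (H ≼ H)

    ≼∧≢⇒≺ : ∀ {H G} → H ≼ G ≡ true → H ≢ G → (H ≺ G) ≡ true
    ≼∧≢⇒≺ {H} {G} le H≢G rewrite le | isYes-≢ H≢G = refl

    -- Adding the term of G to both sides turns the strict interval into the full one, which is a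
    -- boolean lattice.
    ∑-strictlyBelow : ∀ G (a : ℕ → ℕ) → ∑ (λ H → 𝟙 (H ≺ G) * a (rank H)) faces ≡ binSum< (rank G) a
    ∑-strictlyBelow G a = ℕₚ.+-cancelʳ-≡ (a (rank G)) _ _ (begin
      ∑ (λ H → 𝟙 (H ≺ G) * a (rank H)) faces + a (rank G)
        ≡⟨ cong (∑ (λ H → 𝟙 (H ≺ G) * a (rank H)) faces +_) (sym (∑-select G (a ∘ rank))) ⟩
      ∑ (λ H → 𝟙 (H ≺ G) * a (rank H)) faces + ∑ (λ H → 𝟙 (isYes (G ≟ H)) * a (rank H)) faces
        ≡⟨ ∑-+ _ _ faces ⟨
      ∑ (λ H → 𝟙 (H ≺ G) * a (rank H) + 𝟙 (isYes (G ≟ H)) * a (rank H)) faces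
        ≡⟨ ∑-cong faces term ⟩
      ∑ (λ H → 𝟙 (H ≼ G) * a (rank H)) faces
        ≡⟨ ∑-reindex (a ∘ rank) ⟩
      ∑ (a ∘ rank ∘ ψ) (allSubsets r)
        ≡⟨ ∑-cong (allSubsets r) (λ τ → cong a (rank-ψ G τ)) ⟩
      ∑ (λ τ → a ∣ τ ∣) (allSubsets r)
        ≡⟨ trans (∑-binSum r a) (binSum-last r a) ⟩
      binSum< r a + a r ∎)
      where
      open ≡-Reasoning
      open Interval G
      term : ∀ H → 𝟙 (H ≺ G) * a (rank H) + 𝟙 (isYes (G ≟ H)) * a (rank H) ≡ 𝟙 (H ≼ G) * a (rank H)
      term H with G ≟ H
      ... | yes refl rewrite ≺-irrefl {G} | ≼-refl G = refl
      ... | no G≢H rewrite isYes-≢ {a = H} {b = G} (λ e → G≢H (sym e)) | Boolₚ.∧-identityʳ (H ≼ G) =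
        ℕₚ.+-identityʳ _

    rank-empty : rank empty ≡ 0
    rank-empty = 2^-injective _ 0 (trans (sym (∑-below empty))
      (∑-uniqueFin (λ H → H ≼ empty) empty (≼-refl empty) (λ x e → ≼-antisym empty x (empty-min x) e)))

    rank≡0⇒empty : ∀ {G} → rank G ≡ 0 → empty ≡ G
    rank≡0⇒empty {G} eq with Interval.ψ-onto G (empty-min G) | Interval.ψ-onto G (≼-refl G)
    ... | σ , σ↦empty | τ , τ↦G = trans (sym σ↦empty) (trans (cong (Interval.ψ G) (same σ τ eq)) τ↦G)
      where
      same : ∀ {m} (σ τ : Subset m) → m ≡ 0 → σ ≡ τ
      same [] [] refl = refl

    δ₀-empty : ∀ G → δ₀ (rank G) ≡ 𝟙 (isYes (empty ≟ G))
    δ₀-empty G with empty ≟ G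
    ... | yes refl rewrite rank-empty = refl
    ... | no empty≢G with rank G in eq
    ...   | zero  = ⊥-elim (empty≢G (rank≡0⇒empty eq))
    ...   | suc _ = refl

    Comparable : Fin N → Fin N → Set
    Comparable x y = x ≼ y ≡ true ⊎ y ≼ x ≡ true

    infix 4 _∈ᵇ_
    _∈ᵇ_ : Fin N → Subset N → Set
    x ∈ᵇ σ = lookup σ x ≡ true

    IsChain : Subset N → Set
    IsChain σ = ∀ x → x ∈ᵇ σ → x ≢ empty × (∀ y → y ∈ᵇ σ → Comparable x y)

    sdFace⇒chain : ∀ σ → sdFace Δ σ ≡ true → IsChain σ
    sdFace⇒chain σ e x x∈σ with allB-sound _ faces e (∈-allFin x)
    ... | ex rewrite x∈σ with ∧-true {not (isYes (x ≟ empty))} ex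
    ...   | x≢ , cmp = not-isYes⇒≢ x≢ , comparable
      where
      comparable : ∀ y → y ∈ᵇ σ → Comparable x y
      comparable y y∈σ with allB-sound _ faces cmp (∈-allFin y)
      ... | ey rewrite y∈σ with x ≼ y | ey
      ...   | true  | _  = inj₁ refl
      ...   | false | ey = inj₂ ey

    chain⇒sdFace : ∀ σ → IsChain σ → sdFace Δ σ ≡ true
    chain⇒sdFace σ chain = allB-complete _ faces outer
      where
      inner : ∀ x → x ∈ᵇ σ → ∀ y → (not (lookup σ y) ∨ (x ≼ y) ∨ (y ≼ x)) ≡ true
      inner x x∈σ y with lookup σ y in eq
      ... | false = refl
      ... | true with proj₂ (chain x x∈σ) y eq
      ...   | inj₁ le rewrite le = refl
      ...   | inj₂ ge rewrite ge = Boolₚ.∨-zeroʳ (x ≼ y)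
      outer : ∀ x → (not (lookup σ x) ∨ (not (isYes (x ≟ empty)) ∧
                 allB (λ y → not (lookup σ y) ∨ (x ≼ y) ∨ (y ≼ x)) faces)) ≡ true
      outer x with lookup σ x in eq
      ... | false = refl
      ... | true  = true-∧ (cong not (isYes-≢ (proj₁ (chain x eq)))) (allB-complete _ faces (inner x eq))

    allIn : (Fin N → Bool) → Subset N → Bool
    allIn D σ = allB (λ x → not (lookup σ x) ∨ D x) faces

    allIn-sound : ∀ D σ → allIn D σ ≡ true → ∀ x → x ∈ᵇ σ → D x ≡ true
    allIn-sound D σ e x x∈σ with allB-sound _ faces e (∈-allFin x)
    ... | ex rewrite x∈σ = ex

    allIn-complete : ∀ D σ → (∀ x → x ∈ᵇ σ → D x ≡ true) → allIn D σ ≡ true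
    allIn-complete D σ all = allB-complete _ faces term
      where
      term : ∀ x → (not (lookup σ x) ∨ D x) ≡ true
      term x with lookup σ x in eq
      ... | false = refl
      ... | true  = all x eq

    chains : ℕ → (Fin N → Bool) → ℕ
    chains j D = ∑ (λ σ → 𝟙 ((sdFace Δ σ ∧ allIn D σ) ∧ (∣ σ ∣ ==ℕ j))) (allSubsets N)

    chains-zero : ∀ D → chains 0 D ≡ 1
    chains-zero D = ∑-uniqueSubset _ ∅
      (true-∧ (true-∧ (chain⇒sdFace ∅ (λ x x∈ → ⊥-elim (none x x∈)))
                      (allIn-complete D ∅ (λ x x∈ → ⊥-elim (none x x∈))))
              (cong (_==ℕ 0) (Subₚ.∣⊥∣≡0 N)))
      (λ τ e → ∅-unique τ (==ℕ-sound (proj₂ (∧-true {sdFace Δ τ ∧ allIn D τ} e))))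
      where
      none : ∀ {m} (x : Fin m) → ¬ lookup ∅ x ≡ true
      none zero    ()
      none (suc x) e = none x e
      ∅-unique : ∀ {m} (τ : Subset m) → ∣ τ ∣ ≡ 0 → ∅ ≡ τ
      ∅-unique []          _ = refl
      ∅-unique (false ∷ τ) e = cong (false ∷_) (∅-unique τ e)

    -- A running maximum, started at some member of σ, which exists because σ is nonempty.
    chain-top : ∀ σ → IsChain σ → ∀ {j} → ∣ σ ∣ ≡ suc j → ∃ λ G → G ∈ᵇ σ × (∀ x → x ∈ᵇ σ → x ≼ G ≡ true)
    chain-top σ chain eq with go faces
      where
      go : (xs : List (Fin N)) → ∃ λ G → G ∈ᵇ σ × (∀ x → x ∈ xs → x ∈ᵇ σ → x ≼ G ≡ true)
      go [] with ∣σ∣>0 σ eq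
      ... | x , x∈σ = x , x∈σ , λ _ ()
      go (y ∷ xs) with go xs | lookup σ y in y∈
      ... | G , G∈σ , top | false = G , G∈σ , λ { x (here refl) x∈σ → absurdᵇ y∈ x∈σ ; x (there x∈) x∈σ → top x x∈ x∈σ }
      ... | G , G∈σ , top | true with proj₂ (chain G G∈σ) y y∈
      ...   | inj₂ y≼G = G , G∈σ , λ { x (here refl) x∈σ → y≼G ; x (there x∈) x∈σ → top x x∈ x∈σ }
      ...   | inj₁ G≼y = y , y∈ , λ { x (here refl) x∈σ → ≼-refl y
                                    ; x (there x∈) x∈σ → ≼-trans x G y (top x x∈ x∈σ) G≼y }
    ... | G , G∈σ , top = G , G∈σ , λ x x∈σ → top x (∈-allFin x) x∈σ

    -- sort the nonempty chains by their largest face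
    chains-suc : ∀ j D → (∀ x y → D y ≡ true → x ≼ y ≡ true → D x ≡ true) →
      chains (suc j) D ≡ ∑ (λ G → 𝟙 (D G ∧ not (isYes (G ≟ empty))) * chains j (_≺ G)) faces
    chains-suc j D D-down = begin
      ∑ (λ σ → 𝟙 (P σ)) (allSubsets N)
        ≡⟨ ∑-cong (allSubsets N) unique-top ⟩
      ∑ (λ σ → ∑ (λ G → 𝟙 (Q G σ)) faces) (allSubsets N)
        ≡⟨ ∑-swap _ (allSubsets N) faces ⟩
      ∑ (λ G → ∑ (λ σ → 𝟙 (Q G σ)) (allSubsets N)) faces
        ≡⟨ ∑-cong faces (λ G → trans (∑-insert G (λ σ → 𝟙 (Q G σ)) (λ σ → 𝟙 (D′ G) * 𝟙 (R G σ)) (Q-out G) (R-in G) (insert G))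
                                     (∑-*ˡ (𝟙 (D′ G)) _ (allSubsets N))) ⟩
      ∑ (λ G → 𝟙 (D′ G) * chains j (_≺ G)) faces ∎
      where
      open ≡-Reasoning
      D′ : Fin N → Bool
      D′ G = D G ∧ not (isYes (G ≟ empty))
      P : Subset N → Bool
      P σ = (sdFace Δ σ ∧ allIn D σ) ∧ (∣ σ ∣ ==ℕ suc j)
      Q R : Fin N → Subset N → Bool
      Q G σ = P σ ∧ (lookup σ G ∧ allIn (_≼ G) σ)
      R G σ = (sdFace Δ σ ∧ allIn (_≺ G) σ) ∧ (∣ σ ∣ ==ℕ j)

      unique-top : ∀ σ → 𝟙 (P σ) ≡ ∑ (λ G → 𝟙 (Q G σ)) faces
      unique-top σ with P σ in eq
      ... | false = sym (∑-zero faces (λ _ → refl))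
      ... | true with ∧-true {sdFace Δ σ ∧ allIn D σ} eq
      ...   | e , size with chain-top σ (sdFace⇒chain σ (proj₁ (∧-true {sdFace Δ σ} e))) (==ℕ-sound size)
      ...     | G , G∈σ , top = sym (∑-uniqueFin (λ G → lookup σ G ∧ allIn (_≼ G) σ) G
                  (true-∧ G∈σ (allIn-complete (_≼ G) σ top))
                  (λ H e → let (H∈σ , topH) = ∧-true {lookup σ H} e in
                     ≼-antisym G H (allIn-sound (_≼ H) σ topH G G∈σ) (top H H∈σ)))

      Q-out : ∀ G σ → lookup σ G ≡ false → 𝟙 (Q G σ) ≡ 0
      Q-out G σ eq rewrite eq = cong 𝟙 (Boolₚ.∧-zeroʳ (P σ))

      R-in : ∀ G σ → lookup σ G ≡ true → 𝟙 (D′ G) * 𝟙 (R G σ) ≡ 0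
      R-in G σ G∈σ = trans (cong (λ b → 𝟙 (D′ G) * 𝟙 b) (≢true⇒false absurd)) (ℕₚ.*-zeroʳ (𝟙 (D′ G)))
        where
        absurd : ¬ R G σ ≡ true
        absurd e with allIn-sound (_≺ G) σ (proj₂ (∧-true {sdFace Δ σ} (proj₁ (∧-true {sdFace Δ σ ∧ allIn (_≺ G) σ} e)))) G G∈σ
        ... | G≺G with trans (sym G≺G) (≺-irrefl {G})
        ...   | ()

      insert : ∀ G σ → lookup σ G ≡ false → 𝟙 (Q G (σ [ G ]≔ true)) ≡ 𝟙 (D′ G) * 𝟙 (R G σ)
      insert G σ G∉σ = trans (cong 𝟙 (bool-iff forth back)) (𝟙-∧ (D′ G) (R G σ))
        where
        σ⁺ = σ [ G ]≔ true
        G∈ : G ∈ᵇ σ⁺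
        G∈ = Vecₚ.lookup∘updateAt G σ
        keep : ∀ x → x ≢ G → lookup σ⁺ x ≡ lookup σ x
        keep x x≢G = Vecₚ.lookup∘updateAt′ x G x≢G σ
        ∈⇒≢ : ∀ x → x ∈ᵇ σ → x ≢ G
        ∈⇒≢ x x∈σ refl with trans (sym x∈σ) G∉σ
        ... | ()
        grow : ∀ x → x ∈ᵇ σ → x ∈ᵇ σ⁺
        grow x x∈σ = trans (keep x (∈⇒≢ x x∈σ)) x∈σ

        forth : Q G σ⁺ ≡ true → D′ G ∧ R G σ ≡ true
        forth e with ∧-true {P σ⁺} e
        ... | eP , eG with ∧-true {sdFace Δ σ⁺ ∧ allIn D σ⁺} eP | ∧-true {lookup σ⁺ G} eG
        ...   | eF , size | _ , top with ∧-true {sdFace Δ σ⁺} eF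
        ...     | eS , eD = true-∧
          (true-∧ (allIn-sound D σ⁺ eD G G∈) (cong not (isYes-≢ (proj₁ (sdFace⇒chain σ⁺ eS G G∈)))))
          (true-∧ (true-∧
            (chain⇒sdFace σ (λ x x∈σ → proj₁ (sdFace⇒chain σ⁺ eS x (grow x x∈σ)) ,
               λ y y∈σ → proj₂ (sdFace⇒chain σ⁺ eS x (grow x x∈σ)) y (grow y y∈σ)))
            (allIn-complete (_≺ G) σ (λ x x∈σ →
               ≼∧≢⇒≺ (allIn-sound (_≼ G) σ⁺ top x (grow x x∈σ)) (∈⇒≢ x x∈σ))))
            (trans (cong (_==ℕ suc j) (sym (∣insert∣ G σ G∉σ))) size))

        back : D′ G ∧ R G σ ≡ true → Q G σ⁺ ≡ true
        back e with ∧-true {D′ G} e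
        ... | eG , eR with ∧-true {D G} eG | ∧-true {sdFace Δ σ ∧ allIn (_≺ G) σ} eR
        ...   | DG , G≢ | eF , size with ∧-true {sdFace Δ σ} eF
        ...     | eS , eB = true-∧ (true-∧ (true-∧ (chain⇒sdFace σ⁺ chain⁺) (allIn-complete D σ⁺ inD))
                                  (trans (cong (_==ℕ suc j) (∣insert∣ G σ G∉σ)) size))
                           (true-∧ G∈ (allIn-complete (_≼ G) σ⁺ below))
          where
          split : ∀ x → x ∈ᵇ σ⁺ → x ≡ G ⊎ x ∈ᵇ σ
          split x x∈ with x ≟ G
          ... | yes x≡G = inj₁ x≡G
          ... | no x≢G  = inj₂ (trans (sym (keep x x≢G)) x∈)
          below : ∀ x → x ∈ᵇ σ⁺ → x ≼ G ≡ true
          below x x∈ with split x x∈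
          ... | inj₁ refl = ≼-refl x
          ... | inj₂ x∈σ  = ≺⇒≼ (allIn-sound (_≺ G) σ eB x x∈σ)
          -- The members of σ lie below the new top G, so closure of `D` downwards puts them into
          -- `D`.
          inD : ∀ x → x ∈ᵇ σ⁺ → D x ≡ true
          inD x x∈ = D-down x G DG (below x x∈)
          chain⁺ : IsChain σ⁺
          chain⁺ x x∈ with split x x∈
          ... | inj₁ refl = not-isYes⇒≢ G≢ , λ y y∈ → inj₂ (below y y∈)
          ... | inj₂ x∈σ  = proj₁ (sdFace⇒chain σ eS x x∈σ) , cmp
            where
            cmp : ∀ y → y ∈ᵇ σ⁺ → Comparable x y
            cmp y y∈ with split y y∈
            ... | inj₁ refl = inj₁ (below x x∈)
            ... | inj₂ y∈σ  = proj₂ (sdFace⇒chain σ eS x x∈σ) y y∈σ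

    private
      drop-empty : ∀ (D : Fin N → Bool) j → (∀ G → G ≢ empty → chains j (_≺ G) ≡ osp (rank G) (suc j)) →
        ∀ G → 𝟙 (D G ∧ not (isYes (G ≟ empty))) * chains j (_≺ G) ≡ 𝟙 (D G) * osp (rank G) (suc j)
      drop-empty D j known G with G ≟ empty
      -- The empty face is excluded on the left; on the right `osp 0 (suc j)` is 0.
      ... | yes refl rewrite rank-empty | Boolₚ.∧-zeroʳ (D G) = sym (ℕₚ.*-zeroʳ (𝟙 (D G)))
      ... | no G≢ rewrite Boolₚ.∧-identityʳ (D G) = cong (𝟙 (D G) *_) (known G G≢)

    -- With G appended, the successive differences of a chain form an ordered partition of the
    -- vertices of G into j + 1 blocks. The empty face is an exception: the empty chain lies below
    -- it, but `osp 0 1` is 0.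
    chains-osp : ∀ j G → G ≢ empty → chains j (_≺ G) ≡ osp (rank G) (suc j)
    chains-osp zero G G≢ = begin
      chains 0 (_≺ G)
        ≡⟨ chains-zero (_≺ G) ⟩
      1
        ≡⟨ cong 𝟙 (≼∧≢⇒≺ (empty-min G) (λ e → G≢ (sym e))) ⟨
      𝟙 (empty ≺ G)
        ≡⟨ ∑-select empty (λ H → 𝟙 (H ≺ G)) ⟨
      ∑ (λ H → 𝟙 (isYes (empty ≟ H)) * 𝟙 (H ≺ G)) faces
        ≡⟨ ∑-cong faces (λ H → trans (ℕₚ.*-comm _ (𝟙 (H ≺ G))) (cong (𝟙 (H ≺ G) *_) (sym (δ₀-empty H)))) ⟩
      ∑ (λ H → 𝟙 (H ≺ G) * δ₀ (rank H)) faces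
        ≡⟨ ∑-strictlyBelow G δ₀ ⟩
      osp (rank G) 1 ∎
      where open ≡-Reasoning
    chains-osp (suc j) G G≢ = trans (chains-suc j (_≺ G) down)
      (trans (∑-cong faces (drop-empty (_≺ G) j (chains-osp j)))
             (∑-strictlyBelow G (λ i → osp i (suc j))))
      where
      down : ∀ x y → (y ≺ G) ≡ true → x ≼ y ≡ true → (x ≺ G) ≡ true
      down x y y≺G x≼y = ≼∧≢⇒≺ (≼-trans x y G x≼y (≺⇒≼ y≺G)) x≢G
        where
        x≢G : x ≢ G
        x≢G refl with ≼-antisym x y x≼y (≺⇒≼ y≺G)
        ... | refl with trans (sym y≺G) (≺-irrefl {x})
        ...   | ()

    fVec-sd : ∀ j → fVecOf N (sdFace Δ) j ≡ ∑ (λ G → osp (rank G) j) faces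
    fVec-sd j = trans (count-∑ _ (allSubsets N)) (trans (∑-cong (allSubsets N) restrict) (count-chains j))
      where
      restrict : ∀ σ → 𝟙 (sdFace Δ σ ∧ (∣ σ ∣ ==ℕ j)) ≡ 𝟙 ((sdFace Δ σ ∧ allIn (λ _ → true) σ) ∧ (∣ σ ∣ ==ℕ j))
      restrict σ rewrite allIn-complete (λ _ → true) σ (λ _ _ → refl) | Boolₚ.∧-identityʳ (sdFace Δ σ) = refl
      count-chains : ∀ j → chains j (λ _ → true) ≡ ∑ (λ G → osp (rank G) j) faces
      count-chains zero = trans (chains-zero (λ _ → true)) (sym (trans (∑-cong faces δ₀-empty)
        (∑-uniqueFin (λ G → isYes (empty ≟ G)) empty (isYes-refl empty) (λ x e → isYes-sound e))))
      count-chains (suc j) = trans (chains-suc j (λ _ → true) (λ _ _ _ _ → refl))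
        (∑-cong faces (λ G → trans (drop-empty (λ _ → true) j (chains-osp j) G) (ℕₚ.+-identityʳ _)))

    rank≤d : ∀ F → rank F ≤ dΔ Δ
    rank≤d F = maxList-member rank (∈-allFin F)

    -- The dimension can be read off `fVec-sd`, because `osp r j` vanishes for j > r and is positive
    -- for j = r.
    dSd≡dΔ : dSd Δ ≡ dΔ Δ
    dSd≡dΔ = ℕₚ.≤-antisym (maxList-upper size (allSubsets N) upper) (maxList-upper rank faces lower)
      where
      size : Subset N → ℕ
      size σ = if sdFace Δ σ then ∣ σ ∣ else 0
      upper : ∀ σ → size σ ≤ dΔ Δ
      upper σ with sdFace Δ σ in eq
      ... | false = z≤n
      ... | true with ∑-positive (λ G → osp (rank G) ∣ σ ∣) faces positive
        where
        positive : 0 < ∑ (λ G → osp (rank G) ∣ σ ∣) faces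
        positive = subst (0 <_) (trans (sym (count-∑ _ (allSubsets N))) (fVec-sd ∣ σ ∣))
          (ℕₚ.≤-trans (ℕₚ.≤-reflexive (sym (cong 𝟙 (true-∧ eq (==ℕ-refl ∣ σ ∣)))))
                      (∑-member (λ τ → 𝟙 (sdFace Δ τ ∧ (∣ τ ∣ ==ℕ ∣ σ ∣))) (∈-allSubsets σ)))
      ...   | G , osp>0 = ℕₚ.≤-trans (ℕₚ.≮⇒≥ (λ lt → ℕₚ.<⇒≢ osp>0 (sym (osp-zero lt)))) (rank≤d G)
      lower : ∀ F → rank F ≤ maxList (map size (allSubsets N))
      lower F with ∑-positive (λ σ → 𝟙 (sdFace Δ σ ∧ (∣ σ ∣ ==ℕ rank F))) (allSubsets N) positive
        where
        positive : 0 < ∑ (λ σ → 𝟙 (sdFace Δ σ ∧ (∣ σ ∣ ==ℕ rank F))) (allSubsets N)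
        positive = subst (0 <_) (trans (sym (fVec-sd (rank F))) (count-∑ _ (allSubsets N)))
          (ℕₚ.≤-trans (osp-diag (rank F)) (∑-member (λ G → osp (rank G) (rank F)) (∈-allFin F)))
      ... | σ , pos = subst (_≤ maxList (map size (allSubsets N))) size≡ (maxList-member size (∈-allSubsets σ))
        where
        holds : ∀ {b} → 0 < 𝟙 b → b ≡ true
        holds {true} _ = refl
        size≡ : size σ ≡ rank F
        size≡ with ∧-true {sdFace Δ σ} (holds pos)
        ... | e , e′ rewrite e = ==ℕ-sound e′

    -- This gives h_0 = 1: the complex to which vertices are attached enters exactly once.
    fVecΔ-zero : fVecΔ Δ 0 ≡ 1
    fVecΔ-zero = trans (count-∑ _ faces) (∑-uniqueFin (λ F → rank F ==ℕ 0) empty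
      (cong (_==ℕ 0) rank-empty) (λ x e → rank≡0⇒empty (==ℕ-sound e)))

open FacePoset

-- Coloured complexes and the attachment of vertices with given links.

module Complexes where
  open import Data.Nat.Base using (_+_; _*_)
  open import Data.Nat.Tactic.RingSolver using (solve-∀)
  import Data.Bool.Properties as Boolₚ
  open import Data.Fin.Base using (Fin; zero; suc; fromℕ<; toℕ)
  import Data.Fin.Properties as Finₚ
  open import Data.Fin.Subset using (Subset; ∣_∣; _⊆_; _∈_) renaming (⊥ to ∅)
  import Data.Fin.Subset.Properties as Subₚ
  open import Data.Vec.Base using (Vec; []; _∷_; lookup; here; there)
  open import Data.List.Relation.Unary.All as All using (All; []; _∷_)
  open import Data.List.Relation.Unary.Any using (Any; here; there)

  Family : ℕ → Set
  Family V = Subset V → Bool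

  fv : ∀ {V} → Family V → ℕ → ℕ
  fv {V} = fVecOf V

  fv-∑ : ∀ {V} (L : Family V) i → fv L i ≡ ∑ (λ σ → 𝟙 (L σ ∧ (∣ σ ∣ ==ℕ i))) (allSubsets V)
  fv-∑ {V} L i = count-∑ _ (allSubsets V)

  fv-zero : ∀ {V} (L : Family V) i → (∀ σ → L σ ≡ true → ∣ σ ∣ ≢ i) → fv L i ≡ 0
  fv-zero {V} L i no-face = trans (fv-∑ L i) (∑-zero (allSubsets V) (λ σ →
    cong 𝟙 (≢true⇒false (λ e → no-face σ (proj₁ (∧-true {L σ} e)) (==ℕ-sound (proj₂ (∧-true {L σ} e)))))))

  fv-split : ∀ {V} (L : Family (suc V)) i →
    fv L i ≡ shiftℕ (fv (L ∘ (true ∷_))) i + fv (L ∘ (false ∷_)) i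
  fv-split {V} L i = trans (fv-∑ L i) (trans (∑-allSubsets {V} (λ σ → 𝟙 (L σ ∧ (∣ σ ∣ ==ℕ i))))
    (cong₂ _+_ (left i) (sym (fv-∑ (L ∘ (false ∷_)) i))))
    where
    left : ∀ i → ∑ (λ σ → 𝟙 (L (true ∷ σ) ∧ (suc ∣ σ ∣ ==ℕ i))) (allSubsets V) ≡ shiftℕ (fv (L ∘ (true ∷_))) i
    left zero    = ∑-zero (allSubsets V) (λ σ → cong 𝟙 (Boolₚ.∧-zeroʳ (L (true ∷ σ))))
    left (suc i) = sym (fv-∑ (L ∘ (true ∷_)) i)

  pad : ∀ {A : Set} {V} (as : List A) → Family V → Family (length as + V)
  pad []       L σ           = L σ
  pad (_ ∷ as) L (true ∷ σ)  = false
  pad (_ ∷ as) L (false ∷ σ) = pad as L σ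

  fv-pad : ∀ {A : Set} {V} (as : List A) (L : Family V) i → fv (pad as L) i ≡ fv L i
  fv-pad []       L i = refl
  fv-pad (a ∷ as) L i = trans (fv-split (pad (a ∷ as) L) i)
    (cong₂ _+_ (absent i) (fv-pad as L i))
    where
    absent : ∀ i → shiftℕ (fv (λ σ → pad (a ∷ as) L (true ∷ σ))) i ≡ 0
    absent zero    = refl
    absent (suc i) = fv-zero (λ σ → pad (a ∷ as) L (true ∷ σ)) i (λ _ ())

  -- Adds to K one new vertex for each tagged family (s , L) with r ≤ s, with link L;
  -- the other ones contribute a vertex lying in no face, so that the vertex set does
  -- not depend on r.
  attach : ∀ {V} (r : ℕ) → Family V → (as : List (ℕ × Family V)) → Family (length as + V)
  attach r K []             σ           = K σ
  attach r K ((s , L) ∷ as) (true ∷ σ)  = (r ≤ᵇ s) ∧ pad as L σ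
  attach r K (_ ∷ as)       (false ∷ σ) = attach r K as σ

  tailF : ∀ {V} → ℕ → List (ℕ × Family V) → ℕ → ℕ
  tailF r as i = ∑ (λ a → 𝟙 (r ≤ᵇ proj₁ a) * fv (proj₂ a) i) as

  shiftℕ-+ : ∀ f g i → shiftℕ (λ j → f j + g j) i ≡ shiftℕ f i + shiftℕ g i
  shiftℕ-+ f g zero    = refl
  shiftℕ-+ f g (suc i) = refl

  shiftℕ-cong : ∀ {f g : ℕ → ℕ} → (∀ i → f i ≡ g i) → ∀ i → shiftℕ f i ≡ shiftℕ g i
  shiftℕ-cong f≈g zero    = refl
  shiftℕ-cong f≈g (suc i) = f≈g i

  -- No two new vertices share a face, so each one contributes t times the f-polynomial of its link.
  fv-attach : ∀ {V} r (K : Family V) as i → fv (attach r K as) i ≡ fv K i + shiftℕ (tailF r as) i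
  fv-attach r K [] zero    = sym (ℕₚ.+-identityʳ _)
  fv-attach r K [] (suc i) = sym (ℕₚ.+-identityʳ _)
  fv-attach {V} r K ((s , L) ∷ as) i = begin
    fv (attach r K ((s , L) ∷ as)) i
      ≡⟨ fv-split (attach r K ((s , L) ∷ as)) i ⟩
    shiftℕ (fv (λ σ → (r ≤ᵇ s) ∧ pad as L σ)) i + fv (attach r K as) i
      ≡⟨ cong₂ _+_ (shiftℕ-cong masked i) (fv-attach r K as i) ⟩
    shiftℕ (λ j → 𝟙 (r ≤ᵇ s) * fv L j) i + (fv K i + shiftℕ (tailF r as) i)
      ≡⟨ lem (shiftℕ (λ j → 𝟙 (r ≤ᵇ s) * fv L j) i) (fv K i) (shiftℕ (tailF r as) i) ⟩
    fv K i + (shiftℕ (λ j → 𝟙 (r ≤ᵇ s) * fv L j) i + shiftℕ (tailF r as) i)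
      ≡⟨ cong (fv K i +_) (shiftℕ-+ (λ j → 𝟙 (r ≤ᵇ s) * fv L j) (tailF r as) i) ⟨
    fv K i + shiftℕ (tailF r ((s , L) ∷ as)) i ∎
    where
    open ≡-Reasoning
    lem : ∀ a b c → a + (b + c) ≡ b + (a + c)
    lem = solve-∀
    masked : ∀ j → fv (λ σ → (r ≤ᵇ s) ∧ pad as L σ) j ≡ 𝟙 (r ≤ᵇ s) * fv L j
    masked j with r ≤ᵇ s
    ... | true  = trans (fv-pad as L j) (sym (ℕₚ.+-identityʳ _))
    ... | false = fv-zero {length as + V} (λ _ → false) j (λ _ ())

  infix 4 _⊑_
  _⊑_ : ∀ {V} → Family V → Family V → Set
  L ⊑ K = ∀ σ → L σ ≡ true → K σ ≡ true

  DownClosed : ∀ {V} → Family V → Set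
  DownClosed L = ∀ σ τ → τ ⊆ σ → L σ ≡ true → L τ ≡ true

  pad⊑attach : ∀ {V} r as {L K : Family V} → L ⊑ K → pad as L ⊑ attach r K as
  pad⊑attach r []       L⊑K σ           e = L⊑K σ e
  pad⊑attach r (_ ∷ as) L⊑K (false ∷ σ) e = pad⊑attach r as L⊑K σ e

  attach⊑attach : ∀ {V} r (K : Family V) as → attach r K as ⊑ attach 0 K as
  attach⊑attach r K []             σ           e = e
  attach⊑attach r K ((s , L) ∷ as) (true ∷ σ)  e = proj₂ (∧-true {r ≤ᵇ s} e)
  attach⊑attach r K (_ ∷ as)       (false ∷ σ) e = attach⊑attach r K as σ e

  pad-down : ∀ {A : Set} {V} (as : List A) {L : Family V} → DownClosed L → DownClosed (pad as L)
  pad-down []       dn σ τ τ⊆σ e = dn σ τ τ⊆σ e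
  pad-down (_ ∷ as) dn (false ∷ σ) (false ∷ τ) τ⊆σ e = pad-down as dn σ τ (Subₚ.drop-∷-⊆ τ⊆σ) e
  pad-down (_ ∷ as) dn (false ∷ σ) (true ∷ τ)  τ⊆σ e with τ⊆σ here
  ... | ()

  attach-down : ∀ {V} r {K : Family V} as → DownClosed K →
    All (λ a → DownClosed (proj₂ a) × proj₂ a ⊑ K) as → DownClosed (attach r K as)
  attach-down r [] dn [] = dn
  attach-down r ((s , L) ∷ as) dn ((L-dn , L⊑K) ∷ links) (true ∷ σ) (true ∷ τ) τ⊆σ e =
    true-∧ (proj₁ (∧-true {r ≤ᵇ s} e)) (pad-down as L-dn σ τ (Subₚ.drop-∷-⊆ τ⊆σ) (proj₂ (∧-true {r ≤ᵇ s} e)))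
  -- Deleting the new vertex leaves a face of its link, and links lie in K.
  attach-down r ((s , L) ∷ as) dn ((L-dn , L⊑K) ∷ links) (true ∷ σ) (false ∷ τ) τ⊆σ e =
    pad⊑attach r as L⊑K τ (pad-down as L-dn σ τ (Subₚ.drop-∷-⊆ τ⊆σ) (proj₂ (∧-true {r ≤ᵇ s} e)))
  attach-down r ((s , L) ∷ as) dn (_ ∷ links) (false ∷ σ) (false ∷ τ) τ⊆σ e =
    attach-down r as dn links σ τ (Subₚ.drop-∷-⊆ τ⊆σ) e
  attach-down r ((s , L) ∷ as) dn (_ ∷ links) (false ∷ σ) (true ∷ τ) τ⊆σ e with τ⊆σ here
  ... | ()

  -- M is both the number of available colours and a bound on face sizes. Colours are plain numbers,
  -- so raising M leaves them as they are.
  record Complex (M : ℕ) : Set where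
    field
      V      : ℕ
      colour : Vec ℕ V
      face   : Family V
      ∅-face : face ∅ ≡ true
      down   : DownClosed face
      proper : ∀ σ → face σ ≡ true → ∀ x y → x ∈ σ → y ∈ σ → lookup colour x ≡ lookup colour y → x ≡ y
      colour<M : ∀ x → lookup colour x < M
      size≤M   : ∀ σ → face σ ≡ true → ∣ σ ∣ ≤ M

  open Complex public

  -- A face with M vertices certifies that `dimPlus1` is M, the number of colours.
  HasFace : ∀ {V} → ℕ → Family V → Set
  HasFace M L = ∃ λ σ → L σ ≡ true × ∣ σ ∣ ≡ M

  Subcomplex : ∀ {M} (C : Complex M) → Family (V C) → Set
  Subcomplex C L = DownClosed L × L ⊑ face C

  -- a possible link of a new vertex of colour m - 1
  Link : ∀ {M} (C : Complex M) → ℕ → Family (V C) → Set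
  Link C m L = ∀ σ → L σ ≡ true → suc ∣ σ ∣ ≤ m × (∀ x → x ∈ σ → suc (lookup (colour C) x) < m)

  pad-face : ∀ {A : Set} {V M} (as : List A) {L : Family V} → HasFace M L → HasFace M (pad as L)
  pad-face []       f = f
  pad-face (_ ∷ as) f with pad-face as f
  ... | σ , e , size = false ∷ σ , e , size

  attach-face : ∀ {V M} (K : Family V) as → HasFace M K → HasFace M (attach 0 K as)
  attach-face K []       f = f
  attach-face K (_ ∷ as) f with attach-face K as f
  ... | σ , e , size = false ∷ σ , e , size

  attach-face⁺ : ∀ {V M} (K : Family V) as → Any (λ a → HasFace M (proj₂ a)) as → HasFace (suc M) (attach 0 K as)
  attach-face⁺ K (_ ∷ as) (here f) with pad-face as f
  ... | σ , e , size = true ∷ σ , e , cong suc size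
  attach-face⁺ K (_ ∷ as) (there fs) with attach-face⁺ K as fs
  ... | σ , e , size = false ∷ σ , e , size

  module _ {M m : ℕ} (C : Complex M) (M≤m : M ≤ m) where
    -- In the applications m is M or M + 1. If m = M, the colour m - 1 may already occur in C, but
    -- not in the links, which is enough for properness. The condition 0 < m makes `pred m` a legal
    -- colour.
    Admissible : ℕ × Family (V C) → Set
    Admissible a = 0 < m × Subcomplex C (proj₂ a) × Link C m (proj₂ a)

    private
      newColour : (as : List (ℕ × Family (V C))) → Vec ℕ (length as + V C)
      newColour []       = colour C
      newColour (_ ∷ as) = pred m ∷ newColour as

      pred< : 0 < m → pred m < m
      pred< (s≤s z≤n) = ℕₚ.≤-refl

      m≤suc-pred : ∀ m → m ≤ suc (pred m)
      m≤suc-pred zero    = z≤n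
      m≤suc-pred (suc m) = ℕₚ.≤-refl

      new-∅ : ∀ as → attach 0 (face C) as ∅ ≡ true
      new-∅ []       = ∅-face C
      new-∅ (_ ∷ as) = new-∅ as

      new-colour<m : ∀ as → All Admissible as → ∀ x → lookup (newColour as) x < m
      new-colour<m []       []               x       = ℕₚ.≤-trans (colour<M C x) M≤m
      new-colour<m (_ ∷ as) ((0<m , _) ∷ ad) zero    = pred< 0<m
      new-colour<m (_ ∷ as) (_ ∷ ad)         (suc x) = new-colour<m as ad x

      pad-link : ∀ as {l L} → Link C l L → ∀ σ → pad as L σ ≡ true →
        suc ∣ σ ∣ ≤ l × (∀ x → x ∈ σ → suc (lookup (newColour as) x) < l)
      pad-link []       link σ           e = link σ e
      pad-link (_ ∷ as) link (false ∷ σ) e with pad-link as link σ e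
      ... | size , col = size , λ { (suc x) (there x∈) → col x x∈ }

      new-size : ∀ as → All Admissible as → ∀ σ → attach 0 (face C) as σ ≡ true → ∣ σ ∣ ≤ m
      new-size []       []       σ           e = ℕₚ.≤-trans (size≤M C σ e) M≤m
      new-size (_ ∷ as) ((_ , _ , link) ∷ ad) (true ∷ σ) e = proj₁ (pad-link as link σ e)
      new-size (_ ∷ as) (_ ∷ ad) (false ∷ σ) e = new-size as ad σ e

      new-proper : ∀ as → All Admissible as → ∀ σ → attach 0 (face C) as σ ≡ true →
        ∀ x y → x ∈ σ → y ∈ σ → lookup (newColour as) x ≡ lookup (newColour as) y → x ≡ y
      new-proper [] [] = proper C
      new-proper (_ ∷ as) (_ ∷ ad) (true ∷ σ) e zero zero x∈ y∈ eq = refl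
      -- The other vertices of the face lie in the link, hence have colours below m - 1.
      new-proper (_ ∷ as) ((_ , _ , link) ∷ ad) (true ∷ σ) e zero (suc y) x∈ (there y∈) eq =
        ⊥-elim (ℕₚ.<-irrefl (cong suc (sym eq)) (ℕₚ.<-≤-trans (proj₂ (pad-link as link σ e) y y∈) (m≤suc-pred m)))
      new-proper (_ ∷ as) ((_ , _ , link) ∷ ad) (true ∷ σ) e (suc x) zero (there x∈) y∈ eq =
        ⊥-elim (ℕₚ.<-irrefl (cong suc eq) (ℕₚ.<-≤-trans (proj₂ (pad-link as link σ e) x x∈) (m≤suc-pred m)))
      new-proper (_ ∷ as) ((_ , (_ , L⊑K) , _) ∷ ad) (true ∷ σ) e (suc x) (suc y) (there x∈) (there y∈) eq =
        cong suc (new-proper as ad σ (pad⊑attach 0 as L⊑K σ e) x y x∈ y∈ eq)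
      new-proper (_ ∷ as) (_ ∷ ad) (false ∷ σ) e (suc x) (suc y) (there x∈) (there y∈) eq =
        cong suc (new-proper as ad σ e x y x∈ y∈ eq)

    extend : (as : List (ℕ × Family (V C))) → All Admissible as → Complex m
    extend as ad = record
      { V        = length as + V C
      ; colour   = newColour as
      ; face     = attach 0 (face C) as
      ; ∅-face   = new-∅ as
      ; down     = attach-down 0 as (down C) (All.map (proj₁ ∘ proj₂) ad)
      ; proper   = new-proper as ad
      ; colour<M = new-colour<m as ad
      ; size≤M   = new-size as ad
      }

    extend-link : ∀ as ad {l L} → Link C l L → Link (extend as ad) l (pad as L)
    extend-link as ad link = pad-link as link

    extend-subcomplex : ∀ as ad {L} → Subcomplex C L → Subcomplex (extend as ad) (pad as L)
    extend-subcomplex as ad (dn , L⊑K) = pad-down as dn , pad⊑attach 0 as L⊑K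

    extend-attach : ∀ as ad r → Subcomplex (extend as ad) (attach r (face C) as)
    extend-attach as ad r = attach-down r as (down C) (All.map (proj₁ ∘ proj₂) ad) , attach⊑attach r (face C) as

  -- ⌊(d+2)/2⌋ computes to 1 + ⌊d/2⌋, so every subcomplex of the complex of stage d can be a link in
  -- the construction of stage d + 2.
  subcomplex-link : ∀ {M} (C : Complex M) {L} → Subcomplex C L → Link C (suc M) L
  subcomplex-link C (_ , L⊑K) σ e = s≤s (size≤M C σ (L⊑K σ e)) , λ x _ → s≤s (colour<M C x)

  point : Complex 0
  point = record
    { V = 0 ; colour = [] ; face = λ _ → true ; ∅-face = refl ; down = λ _ _ _ _ → refl
    ; proper = λ _ _ () ; colour<M = λ () ; size≤M = λ { [] _ → z≤n } }

  module _ {M : ℕ} (C : Complex M) where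
    toSimplicialComplex : SimplicialComplex
    toSimplicialComplex = record
      { V = V C ; face = face C ; empty-face = ∅-face C ; down-closed = down C }

    fVec-high : ∀ i → M < i → fVec toSimplicialComplex i ≡ 0
    fVec-high i M<i = fv-zero (face C) i (λ { σ e refl → ℕₚ.<⇒≱ M<i (size≤M C σ e) })

    balanced : HasFace M (face C) → Balanced toSimplicialComplex
    balanced (σ₀ , e₀ , size₀) = subst Goal (sym dim) (c , c-proper)
      where
      size : Subset (V C) → ℕ
      size σ = if face C σ then ∣ σ ∣ else 0
      dim : dimPlus1 toSimplicialComplex ≡ M
      dim = ℕₚ.≤-antisym (maxList-upper size (allSubsets (V C)) upper)
        (subst (_≤ dimPlus1 toSimplicialComplex) (trans (cong (λ b → if b then ∣ σ₀ ∣ else 0) e₀) size₀)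
               (maxList-member size (∈-allSubsets σ₀)))
        where
        upper : ∀ σ → size σ ≤ M
        upper σ with face C σ in e
        ... | true  = size≤M C σ e
        ... | false = z≤n
      Goal : ℕ → Set
      Goal D = Σ (Fin (V C) → Fin D) λ c →
        ∀ σ → face C σ ≡ true → ∀ x y → x ∈ σ → y ∈ σ → c x ≡ c y → x ≡ y
      c : Fin (V C) → Fin M
      c x = fromℕ< (colour<M C x)
      c-proper : ∀ σ → face C σ ≡ true → ∀ x y → x ∈ σ → y ∈ σ → c x ≡ c y → x ≡ y
      c-proper σ e x y x∈ y∈ eq = proper C σ e x y x∈ y∈
        (trans (sym (Finₚ.toℕ-fromℕ< (colour<M C x))) (trans (cong toℕ eq) (Finₚ.toℕ-fromℕ< (colour<M C y))))

open Complexes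

-- Realizing the γ-polynomials by induction on d.

module Construction where
  open import Data.Nat.Combinatorics using () renaming (_C_ to _choose_)
  open import Data.Integer.Base as ℤ using (ℤ; +_; _+_; _*_)
  import Data.Integer.Properties as ℤₚ
  open import Data.Fin.Subset using (∣_∣) renaming (⊥ to ∅)
  open import Data.List.Relation.Unary.All as All using (All; []; _∷_)
  import Data.List.Relation.Unary.All.Properties as Allₚ
  open import Data.List.Relation.Unary.Any as Any using (Any; here)
  import Data.List.Relation.Unary.Any.Properties as Anyₚ

  -- the polynomial of degree d whose γ-polynomial is t Σ f(L)
  Ψ : ∀ {V} → ℕ → List (Family V) → ℕ → ℤ
  Ψ d Ls = Φ d (shiftℕ (λ i → ∑ (λ L → fv L i) Ls))

  Φ-shiftℕ-+ : ∀ d f g k → Φ d (shiftℕ (λ i → f i ℕ.+ g i)) k ≡ Φ d (shiftℕ f) k + Φ d (shiftℕ g) k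
  Φ-shiftℕ-+ d f g k = trans (Φ-cong d (shiftℕ-+ f g) k) (Φ-+ d (shiftℕ f) (shiftℕ g) k)

  Φ-shiftℕ-zero : ∀ d k → Φ d (shiftℕ (λ _ → 0)) k ≡ + 0
  Φ-shiftℕ-zero d k = trans (Φ-cong d zero-shift k) (Φ-zero d k)
    where
    zero-shift : ∀ i → shiftℕ (λ _ → 0) i ≡ 0
    zero-shift zero    = refl
    zero-shift (suc i) = refl

  Ψ-++ : ∀ {V} d (Ls Ms : List (Family V)) k → Ψ d (Ls ++ Ms) k ≡ Ψ d Ls k + Ψ d Ms k
  Ψ-++ d Ls Ms k = trans (Φ-cong d (shiftℕ-cong (λ i → ∑-++ (λ L → fv L i) Ls Ms)) k)
    (Φ-shiftℕ-+ d (λ i → ∑ (λ L → fv L i) Ls) (λ i → ∑ (λ L → fv L i) Ms) k)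

  Ψ-dup : ∀ {V} d (L : Family V) k →
    Ψ d (L ∷ L ∷ []) k ≡ Φ d (shiftℕ (fv L)) k + Φ d (shiftℕ (fv L)) k
  Ψ-dup d L k = trans
    (Φ-cong d (shiftℕ-cong (λ i → cong (fv L i ℕ.+_) (ℕₚ.+-identityʳ (fv L i)))) k)
    (Φ-shiftℕ-+ d (fv L) (fv L) k)

  Ψ-pad : ∀ {V} d (as : List (ℕ × Family V)) (Ls : List (Family V)) k → Ψ d (map (pad as) Ls) k ≡ Ψ d Ls k
  Ψ-pad {V} d as Ls k = Φ-cong d (shiftℕ-cong (λ i →
    trans (∑-map (λ L → fv L i) (pad {V = V} as) Ls) (∑-cong Ls (λ L → fv-pad as L i)))) k

  -- Bounds the degree of t f(L) by d/2, as `Φ-suc` demands.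
  SmallFor : ∀ {V} → ℕ → Family V → Set
  SmallFor d L = ∀ σ → L σ ≡ true → suc ∣ σ ∣ ℕ.+ suc ∣ σ ∣ ≤ d

  ∑-shift-zero : ∀ {V} d (Ls : List (Family V)) → All (SmallFor d) Ls →
    ∀ i → d < i ℕ.+ i → shiftℕ (λ i → ∑ (λ L → fv L i) Ls) i ≡ 0
  ∑-shift-zero d Ls       small        zero    ()
  ∑-shift-zero d []       []           (suc i) lt = refl
  ∑-shift-zero d (L ∷ Ls) (sm ∷ small) (suc i) lt = cong₂ ℕ._+_
    (fv-zero L i (λ { σ e refl → ℕₚ.<⇒≱ lt (sm σ e) }))
    (∑-shift-zero d Ls small (suc i) lt)

  Ψ-suc : ∀ {V} d (Ls : List (Family V)) → All (SmallFor d) Ls →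
    ∀ k → Ψ (suc d) Ls k ≡ Ψ d Ls k + (Ψ d Ls ↑) k
  Ψ-suc d Ls small = Φ-suc d _ (∑-shift-zero d Ls small)

  link-small : ∀ {M d} (C : Complex M) {L} → Link C ⌊ d /2⌋ L → SmallFor d L
  link-small {d = d} C link σ e = i≤⌊n/2⌋⇒i+i≤n d (proj₁ (link σ e))

  collect : {A : Set} → (ℕ → List A) → ℕ → List (ℕ × A)
  collect f zero    = []
  collect f (suc m) = map (m ,_) (f m) ++ collect f m

  collect-All : {A : Set} {P : A → Set} (f : ℕ → List A) → (∀ r → All P (f r)) →
    ∀ m → All (λ a → proj₁ a < m × P (proj₂ a)) (collect f m)
  collect-All f all zero    = []
  collect-All f all (suc m) = Allₚ.++⁺ (Allₚ.map⁺ (All.map (ℕₚ.≤-refl ,_) (all m)))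
    (All.map (λ { (lt , px) → ℕₚ.m≤n⇒m≤1+n lt , px }) (collect-All f all m))

  collect-Any : {A : Set} {P : A → Set} (f : ℕ → List A) → Any P (f 0) →
    ∀ m → 0 < m → Any (P ∘ proj₂) (collect f m)
  collect-Any f p₀ (suc zero)    _ = Anyₚ.++⁺ˡ (Anyₚ.map⁺ p₀)
  collect-Any f p₀ (suc (suc m)) _ = Anyₚ.++⁺ʳ (map (suc m ,_) (f (suc m))) (collect-Any f p₀ (suc m) (s≤s z≤n))

  Ψtail : ∀ {V} → ℕ → ℕ → List (ℕ × Family V) → ℕ → ℤ
  Ψtail d r as = Φ d (shiftℕ (tailF r as))

  Ψtail-collect : ∀ {V} d (f : ℕ → List (Family V)) (ν : ℕ → ℤ) r m k →
    (∀ s → s < m → Ψ d (f s) k ≡ ν s) → Ψtail d r (collect f m) k ≡ tailSum m ν r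
  Ψtail-collect d f ν r zero    k known = Φ-shiftℕ-zero d k
  Ψtail-collect d f ν r (suc m) k known = trans
    (Φ-cong d (shiftℕ-cong (λ i → trans (∑-++ _ (map (m ,_) (f m)) (collect f m))
       (cong (ℕ._+ tailF r (collect f m) i) (trans (∑-map _ (m ,_) (f m)) (∑-*ˡ (𝟙 (r ≤ᵇ m)) _ (f m)))))) k)
    (trans (Φ-shiftℕ-+ d new (tailF r (collect f m)) k) (trans (ℤₚ.+-comm (Φ d (shiftℕ new) k) (Ψtail d r (collect f m) k))
    (cong₂ _+_ (Ψtail-collect d f ν r m k (λ s s<m → known s (ℕₚ.m≤n⇒m≤1+n s<m))) top)))
    where
    new : ℕ → ℕ
    new i = 𝟙 (r ≤ᵇ m) ℕ.* ∑ (λ L → fv L i) (f m)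
    top : Φ d (shiftℕ new) k ≡ (if r ≤ᵇ m then ν m else + 0)
    top with r ≤ᵇ m
    ... | true  = trans (Φ-cong d (shiftℕ-cong (λ i → ℕₚ.+-identityʳ _)) k) (known m ℕₚ.≤-refl)
    ... | false = Φ-shiftℕ-zero d k

  -- The list for the index 0 is left out, as in `acc`.
  accumulate : {A : Set} → (ℕ → List A) → ℕ → List A
  accumulate f zero    = []
  accumulate f (suc r) = f (suc r) ++ accumulate f r

  accumulate-All : {A : Set} {P : A → Set} (f : ℕ → List A) → (∀ r → All P (f r)) → ∀ r → All P (accumulate f r)
  accumulate-All f all zero    = []
  accumulate-All f all (suc r) = Allₚ.++⁺ (all (suc r)) (accumulate-All f all r)

  Ψ-accumulate : ∀ {V} d (f : ℕ → List (Family V)) (ν : ℕ → ℤ) r k →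
    (∀ s → s < r → Ψ d (f (suc s)) k ≡ ν s) → Ψ d (accumulate f r) k ≡ headSum r ν
  Ψ-accumulate d f ν zero    k known = Φ-shiftℕ-zero d k
  Ψ-accumulate d f ν (suc r) k known = trans (Ψ-++ d (f (suc r)) (accumulate f r) k)
    (trans (ℤₚ.+-comm (Ψ d (f (suc r)) k) (Ψ d (accumulate f r) k)) (cong₂ _+_ (Ψ-accumulate d f ν r k (λ s s<r → known s (ℕₚ.m≤n⇒m≤1+n s<r)))
                                      (known r ℕₚ.≤-refl)))

  above : {A : Set} → ℕ → List (ℕ × A) → List A
  above r []             = []
  above r ((s , L) ∷ as) = (if r ≤ᵇ s then L ∷ [] else []) ++ above r as

  above-All : {A : Set} {P : A → Set} (r : ℕ) {as : List (ℕ × A)} → All (P ∘ proj₂) as → All P (above r as)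
  above-All r []                     = []
  above-All {P = P} r {(s , L) ∷ as} (pL ∷ ps) with r ≤ᵇ s
  ... | true  = pL ∷ above-All r ps
  ... | false = above-All r ps

  Ψ-above : ∀ {V} d r (as : List (ℕ × Family V)) k → Ψ d (above r as) k ≡ Ψtail d r as k
  Ψ-above d r as k = Φ-cong d (shiftℕ-cong (λ i → lem i as)) k
    where
    lem : ∀ i as → ∑ (λ L → fv L i) (above r as) ≡ tailF r as i
    lem i []             = refl
    lem i ((s , L) ∷ as) with r ≤ᵇ s
    ... | true  = cong₂ ℕ._+_ (sym (ℕₚ.+-identityʳ (fv L i))) (lem i as)
    ... | false = lem i as

  -- C is the complex K_{d+1}. The γ-polynomials of q½ (d+1) (r+1) and of
  -- w (d+1) r are t times the sums of the f-polynomials of the members of qFam r and wFam r.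
  record Stage (d : ℕ) : Set where
    field
      C        : Complex ⌊ d /2⌋
      C-face   : HasFace ⌊ d /2⌋ (face C)
      euler-Φ  : ∀ k → euler d k ≡ Φ d (fv (face C)) k
      qFam wFam   : ℕ → List (Family (V C))
      qFam-sub  : ∀ r → All (λ L → Subcomplex C L × Link C ⌊ suc d /2⌋ L) (qFam r)
      -- A link of this size forms with its new vertex a face of size ⌊(d+1)/2⌋, so the dimension
      -- keeps up with the number of colours.
      qFam-face : ∀ r → suc r ℕ.+ suc r ≤ suc d → Any (HasFace (pred ⌊ suc d /2⌋)) (qFam r)
      qFam-Ψ    : ∀ r → suc r ℕ.+ suc r ≤ suc d → ∀ k → q½ (suc d) (suc r) k ≡ Ψ (suc d) (qFam r) k
      -- No colour bound is recorded: these families become links only after passing into `qFam` of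
      -- the next stage, where `subcomplex-link` provides the bound.
      wFam-sub   : ∀ r → All (Subcomplex C) (wFam r)
      wFam-face  : Any (HasFace ⌊ d /2⌋) (wFam 0)
      wFam-Ψ     : ∀ r → r ℕ.+ r ≤ suc d → ∀ k → w (suc d) r k ≡ Ψ (suc (suc d)) (wFam r) k

  whole : ∀ {M} (C : Complex M) → Subcomplex C (face C)
  whole C = down C , λ _ e → e

  w-first-Ψ : ∀ d {V} (K : Family V) → (∀ k → euler d k ≡ Φ d (fv K) k) →
    ∀ k → w (suc d) 0 k ≡ Ψ (suc (suc d)) (K ∷ K ∷ []) k
  w-first-Ψ d K euler-Φ k = trans (w-first d k) (trans (cong₂ _+_ eq eq) (sym (Ψ-dup (suc (suc d)) K k)))
    where
    eq : (euler d ↑) k ≡ Φ (suc (suc d)) (shiftℕ (fv K)) k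
    eq = trans (↑-cong euler-Φ k) (sym (Φ-shift d (fv K) k))

  -- The Eulerian polynomial of one letter is 1, realized by the complex whose only face is empty.
  -- No r satisfies 2(r+1) ≤ 1, so `qFam` may be empty.
  stage₀ : Stage 0
  stage₀ = record
    { C = point ; C-face = ∅ , refl , refl ; euler-Φ = base
    ; qFam = λ _ → [] ; wFam = λ _ → face point ∷ face point ∷ []
    ; qFam-sub = λ _ → [] ; qFam-face = λ { r (s≤s le) → ⊥-elim (impossible r le) } ; qFam-Ψ = λ { r (s≤s le) → ⊥-elim (impossible r le) }
    ; wFam-sub = λ _ → whole point ∷ whole point ∷ [] ; wFam-face = here (∅ , refl , refl)
    ; wFam-Ψ = λ { zero le → w-first-Ψ 0 (face point) base ; (suc r) (s≤s le) → ⊥-elim (impossible r le) } }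
    where
    impossible : ∀ r → ¬ r ℕ.+ suc r ≤ 0
    impossible r le with subst (_≤ 0) (ℕₚ.+-suc r r) le
    ... | ()
    base : ∀ k → euler 0 k ≡ Φ 0 (fv (face point)) k
    base zero    = refl
    base (suc k) = sumTo-zero (suc k) term
      where
      term : ∀ i → i ≤ suc k → sgn (suc k ∸ i) * + ((0 ∸ i) choose (suc k ∸ i)) * + osp 1 (suc i) ≡ + 0
      term zero    _ = trans (ℤₚ.*-identityʳ _) (ℤₚ.*-zeroʳ (sgn (suc k)))
      term (suc i) _ rewrite osp-zero {1} {suc (suc i)} (s≤s (s≤s z≤n)) =
        ℤₚ.*-zeroʳ (sgn (k ∸ i) * + (0 choose (k ∸ i)))

  module Step {d : ℕ} (st : Stage d) where
    open Stage st
    private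
      D m m′ : ℕ
      D = suc d
      m = ⌊ D /2⌋
      m′ = ⌊ suc D /2⌋
      K : Family (V C)
      K = face C

    ⌊d/2⌋≤m : ⌊ d /2⌋ ≤ m
    ⌊d/2⌋≤m = ℕₚ.⌊n/2⌋-mono (ℕₚ.n≤1+n d)

    q-first-Φ : ∀ k → q D 0 k ≡ Φ D (fv K) k
    q-first-Φ k = trans (q-first d k) (trans (cong₂ _+_ (euler-Φ k) (↑-cong euler-Φ k))
      (sym (Φ-suc d (fv K) small k)))
      where
      small : ∀ i → d < i ℕ.+ i → fv K i ≡ 0
      small i lt = fv-zero K i (λ { σ e refl → ℕₚ.<⇒≱ lt (i≤⌊n/2⌋⇒i+i≤n d (size≤M C σ e)) })

    qFam-Ψ′ : ∀ k s → s < m → Ψ D (qFam s) k ≡ q½ D (suc s) k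
    qFam-Ψ′ k s s<m = sym (qFam-Ψ s (i≤⌊n/2⌋⇒i+i≤n D s<m) k)

    private
      as : List (ℕ × Family (V C))
      as = collect qFam m

      all-small : All (λ a → a .proj₁ < m × Subcomplex C (proj₂ a) × Link C m (proj₂ a)) as
      all-small = collect-All qFam qFam-sub m

      ad : All (Admissible C ⌊d/2⌋≤m) as
      ad = All.map (λ { (s<m , sub , link) → ℕₚ.≤-trans (s≤s z≤n) s<m , sub , link }) all-small

      C′ : Complex m
      C′ = extend C ⌊d/2⌋≤m as ad

      -- The subcomplex keeping only the new vertices with tag at least r. It realizes q_{D,0} plus
      -- the tail, the sum that occurs doubled in `w-unroll`.
      Ktail : ℕ → Family (V C′)
      Ktail r = attach r K as

      tail-Ψ : ∀ r k → tail d r k ≡ Ψtail D r as k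
      tail-Ψ r k = sym (Ψtail-collect D qFam (λ s → q½ D (suc s) k) r m k (qFam-Ψ′ k))

      Ktail-Φ : ∀ r k → Φ D (fv (Ktail r)) k ≡ q D 0 k + tail d r k
      Ktail-Φ r k = trans (Φ-cong D (fv-attach r K as) k) (trans (Φ-+ D (fv K) _ k)
        (cong₂ _+_ (sym (q-first-Φ k)) (sym (tail-Ψ r k))))

      euler-Φ′ : ∀ k → euler D k ≡ Φ D (fv (face C′)) k
      euler-Φ′ k = trans (euler-fold D k) (trans (tailSum-all m (λ s → q½ D s k)) (sym (Ktail-Φ 0 k)))

      -- If ⌊(d+1)/2⌋ = ⌊d/2⌋ the old face of full size remains; otherwise one arises from a new
      -- vertex and a largest link.
      C′-face : HasFace m (face C′)
      C′-face with m ℕₚ.≟ ⌊ d /2⌋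
      ... | yes eq = attach-face K as (subst (λ z → HasFace z K) (sym eq) C-face)
      ... | no m≢  = subst (λ z → HasFace z (face C′)) suc-pred
        (attach-face⁺ K as (collect-Any qFam (qFam-face 0 2≤D) m 0<m))
        where
        0<m : 0 < m
        0<m = ℕₚ.≤-trans (s≤s z≤n) (ℕₚ.≤∧≢⇒< ⌊d/2⌋≤m (λ e → m≢ (sym e)))
        2≤D : 2 ≤ D
        2≤D = i≤⌊n/2⌋⇒i+i≤n D 0<m
        suc-pred : suc (pred m) ≡ m
        suc-pred = ℕₚ.suc-pred m {{ℕ.>-nonZero 0<m}}

      low : ℕ → List (Family (V C))
      low r = wFam 0 ++ accumulate wFam r

      acc-Ψ : ∀ r → suc r ℕ.+ suc r ≤ suc D → ∀ k → Ψ (suc D) (accumulate wFam r) k ≡ acc d r k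
      acc-Ψ r (s≤s le) k = Ψ-accumulate (suc D) wFam (λ s → w D (suc s) k) r k
        (λ s s<r → sym (wFam-Ψ (suc s) (ℕₚ.≤-trans (ℕₚ.+-mono-≤ s<r (ℕₚ.m≤n⇒m≤1+n s<r)) le) k))

      low-Ψ : ∀ r → suc r ℕ.+ suc r ≤ suc D → ∀ k → Ψ (suc D) (low r) k ≡ w D 0 k + acc d r k
      low-Ψ r le k = trans (Ψ-++ (suc D) (wFam 0) (accumulate wFam r) k)
        (cong₂ _+_ (sym (wFam-Ψ 0 z≤n k)) (acc-Ψ r le k))

      -- A transcript of `q-unroll`, or of `q½-middle` at the middle index: `low r` stands for the
      -- sum of the `w`s and `above r as` for the tail times 1 + t. All these families lie in the
      -- old complex C, whose colours are below ⌊d/2⌋, so the colour ⌊d/2⌋ is free for the next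
      -- vertices.
      qFam⁻ : ℕ → List (Family (V C))
      qFam⁻ r = if (suc r ℕ.+ suc r) ==ℕ suc D then low r else (low r ++ low r) ++ above r as

      qFam′ wFam′ : ℕ → List (Family (V C′))
      qFam′ r = map (pad as) (qFam⁻ r)
      wFam′ zero    = face C′ ∷ face C′ ∷ []
      -- Of the terms of `w-unroll`, only 2 t (q_{D,0} + tail) needs families that use the new
      -- vertices.
      wFam′ (suc r) = (Ktail r ∷ Ktail r ∷ []) ++ map (pad as) (accumulate wFam r)

      lift-sub : ∀ {Ls} → All (Subcomplex C) Ls →
        All (λ L → Subcomplex C′ L × Link C′ m′ L) (map (pad as) Ls)
      lift-sub subs = Allₚ.map⁺ (All.map (λ {L} sub →
        extend-subcomplex C ⌊d/2⌋≤m as ad sub , extend-link C ⌊d/2⌋≤m as ad (subcomplex-link C sub)) subs)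

      low-sub : ∀ r → All (Subcomplex C) (low r)
      low-sub r = Allₚ.++⁺ (wFam-sub 0) (accumulate-All wFam wFam-sub r)

      qFam′-sub : ∀ r → All (λ L → Subcomplex C′ L × Link C′ m′ L) (qFam′ r)
      qFam′-sub r with (suc r ℕ.+ suc r) ==ℕ suc D
      ... | true  = lift-sub (low-sub r)
      ... | false = lift-sub (Allₚ.++⁺ (Allₚ.++⁺ (low-sub r) (low-sub r)) (above-All r (All.map (proj₁ ∘ proj₂) all-small)))

      qFam′-face : ∀ r → Any (HasFace ⌊ d /2⌋) (qFam′ r)
      qFam′-face r = Anyₚ.map⁺ (Any.map (pad-face as) old)
        where
        old : Any (HasFace ⌊ d /2⌋) (qFam⁻ r)
        old with (suc r ℕ.+ suc r) ==ℕ suc D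
        ... | true  = Anyₚ.++⁺ˡ wFam-face
        ... | false = Anyₚ.++⁺ˡ (Anyₚ.++⁺ˡ (Anyₚ.++⁺ˡ wFam-face))

      tail-suc-Ψ : ∀ r k → Ψ (suc D) (above r as) k ≡ tail d r k + (tail d r ↑) k
      tail-suc-Ψ r k = trans (Ψ-suc D (above r as) (above-All r (All.map (λ { (_ , _ , link) → link-small {d = D} C link }) all-small)) k)
        (cong₂ _+_ (eq k) (↑-cong eq k))
        where
        eq : ∀ k → Ψ D (above r as) k ≡ tail d r k
        eq k = trans (Ψ-above D r as k) (sym (tail-Ψ r k))

      qFam′-Ψ : ∀ r → suc r ℕ.+ suc r ≤ suc D → ∀ k → q½ (suc D) (suc r) k ≡ Ψ (suc D) (qFam′ r) k
      qFam′-Ψ r le k = trans (old (suc r ℕ.+ suc r ℕₚ.≟ suc D)) (sym (Ψ-pad {V C} (suc D) as (qFam⁻ r) k))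
        where
        old : Dec (suc r ℕ.+ suc r ≡ suc D) → q½ (suc D) (suc r) k ≡ Ψ (suc D) (qFam⁻ r) k
        old (yes eq) = trans (q½-middle d r eq k) (trans (sym (low-Ψ r le k))
          (cong (λ b → Ψ (suc D) (if b then low r else (low r ++ low r) ++ above r as) k)
                (sym (trans (cong (_==ℕ suc D) eq) (==ℕ-refl (suc D))))))
        old (no neq) = trans (q½-off-middle (suc D) (suc r) (ℕₚ.≤∧≢⇒< le neq) k)
          (trans (q-unroll d r le k) (trans (sym unfold)
          (cong (λ b → Ψ (suc D) (if b then low r else (low r ++ low r) ++ above r as) k)
                (sym (==ℕ-false neq)))))
          where
          unfold : Ψ (suc D) ((low r ++ low r) ++ above r as) k
            ≡ ((w D 0 k + w D 0 k) + (acc d r k + acc d r k)) + (tail d r k + (tail d r ↑) k)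
          unfold = trans (Ψ-++ (suc D) (low r ++ low r) (above r as) k) (cong₂ _+_
            (trans (Ψ-++ (suc D) (low r) (low r) k)
            (trans (cong₂ _+_ (low-Ψ r le k) (low-Ψ r le k))
                   (+-interchange (w D 0 k) (acc d r k) (w D 0 k) (acc d r k))))
            (tail-suc-Ψ r k))

      wFam′-sub : ∀ r → All (Subcomplex C′) (wFam′ r)
      wFam′-sub zero    = whole C′ ∷ whole C′ ∷ []
      wFam′-sub (suc r) = extend-attach C ⌊d/2⌋≤m as ad r ∷ extend-attach C ⌊d/2⌋≤m as ad r ∷
        All.map proj₁ (lift-sub (accumulate-All wFam wFam-sub r))

      wFam′-Ψ : ∀ r → r ℕ.+ r ≤ suc D → ∀ k → w (suc D) r k ≡ Ψ (suc (suc D)) (wFam′ r) k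
      wFam′-Ψ zero    le k = w-first-Ψ D (face C′) euler-Φ′ k
      wFam′-Ψ (suc r) le k = trans (w-unroll d r le k) (sym
        (trans (Ψ-++ {V C′} (suc (suc D)) (Ktail r ∷ Ktail r ∷ []) (map (pad as) (accumulate wFam r)) k) (cong₂ _+_
          (trans (Ψ-dup {V C′} (suc (suc D)) (Ktail r) k) (cong₂ _+_ half half))
          (trans (Ψ-pad {V C} (suc (suc D)) as (accumulate wFam r) k)
          (trans (Ψ-suc (suc D) (accumulate wFam r) (All.map (λ sub → link-small {d = suc D} C (subcomplex-link C sub)) (accumulate-All wFam wFam-sub r)) k)
                 (cong₂ _+_ (acc-Ψ r le k) (↑-cong (acc-Ψ r le) k)))))))
        where
        half : Φ (suc (suc D)) (shiftℕ (fv (Ktail r))) k ≡ (q D 0 ↑) k + (tail d r ↑) k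
        half = trans (Φ-shift D (fv (Ktail r)) k) (trans (↑-cong (Ktail-Φ r) k) (↑-+ (q D 0) (tail d r) k))

    next : Stage D
    next = record
      { C = C′ ; C-face = C′-face ; euler-Φ = euler-Φ′ ; qFam = qFam′ ; wFam = wFam′
      ; qFam-sub = qFam′-sub ; qFam-face = λ r _ → qFam′-face r ; qFam-Ψ = qFam′-Ψ
      ; wFam-sub = wFam′-sub ; wFam-face = here C′-face ; wFam-Ψ = wFam′-Ψ }

  stage : ∀ d → Stage d
  stage zero    = stage₀
  stage (suc d) = Step.next (stage d)

  -- Realizing the combination with coefficients h_s.

  copies : {A : Set} → ℕ → List A → List A
  copies zero    xs = []
  copies (suc a) xs = xs ++ copies a xs

  copies-All : {A : Set} {P : A → Set} (a : ℕ) {xs : List A} → All P xs → All P (copies a xs)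
  copies-All zero    ps = []
  copies-All (suc a) ps = Allₚ.++⁺ ps (copies-All a ps)

  copies-Any : {A : Set} {P : A → Set} (a : ℕ) {xs : List A} → Any P xs → copies a xs ≡ [] ⊎ Any P (copies a xs)
  copies-Any zero    ps = inj₁ refl
  copies-Any (suc a) ps = inj₂ (Anyₚ.++⁺ˡ ps)

  Ψ-copies : ∀ {V} d a (Ls : List (Family V)) k → Ψ d (copies a Ls) k ≡ + a * Ψ d Ls k
  Ψ-copies d zero    Ls k = trans (Φ-shiftℕ-zero d k) (sym (ℤₚ.*-zeroˡ (Ψ d Ls k)))
  Ψ-copies d (suc a) Ls k = trans (Ψ-++ d Ls (copies a Ls) k)
    (trans (cong (λ z → Ψ d Ls k + z) (Ψ-copies d a Ls k)) (sym (ℤₚ.suc-* (+ a) (Ψ d Ls k))))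

  -- Some h_s may vanish. Either nothing at all is attached and the dimension stays, or some
  -- attached link has full size and the dimension is the largest possible.
  collect-empty-or-Any : {A : Set} {P : A → Set} (f : ℕ → List A) (m : ℕ) →
    (∀ s → s < m → f s ≡ [] ⊎ Any P (f s)) →
    collect f m ≡ [] ⊎ (0 < m × Any (P ∘ proj₂) (collect f m))
  collect-empty-or-Any f zero    good = inj₁ refl
  collect-empty-or-Any f (suc m) good
    with good m ℕₚ.≤-refl | collect-empty-or-Any f m (λ s s<m → good s (ℕₚ.m≤n⇒m≤1+n s<m))
  ... | inj₂ p    | _              = inj₂ (s≤s z≤n , Anyₚ.++⁺ˡ (Anyₚ.map⁺ p))
  ... | inj₁ _    | inj₂ (_ , p)   = inj₂ (s≤s z≤n , Anyₚ.++⁺ʳ (map (m ,_) (f m)) p)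
  ... | inj₁ eq   | inj₁ eq′       = inj₁ (cong₂ (λ xs ys → map (m ,_) xs ++ ys) eq eq′)

  -- M cannot be fixed as ⌊d/2⌋: if h_s = 0 for all 1 ≤ s ≤ ⌊d/2⌋, nothing is attached and the
  -- dimension may be smaller.
  record Realization (d : ℕ) (a : ℕ → ℤ) : Set where
    field
      M       : ℕ
      M≤d/2   : M ≤ ⌊ d /2⌋
      K       : Complex M
      K-face  : HasFace M (face K)
      a-Φ     : ∀ k → a k ≡ Φ d (fv (face K)) k

  -- h_s disjoint copies of the families realizing q½ d s are attached to the complex
  -- realizing q½ d 0.
  realize : ∀ d (h : ℕ → ℤ) → Nonnegative d h → h 0 ≡ + 1 →
    Realization d (λ k → sumTo ⌊ d /2⌋ (λ s → h s * q½ d s k))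
  realize zero h h≥0 h₀ = record
    { M = 0 ; M≤d/2 = z≤n ; K = C ; K-face = C-face
    -- For d = 0 the index 0 is the middle one, so `q½ 0 0` is `p 0 0 0`, which is `euler 0`.
    ; a-Φ = λ k → trans (trans (cong (_* q½ 0 0 k) h₀) (ℤₚ.*-identityˡ (q½ 0 0 k)))
                        (trans (sym (euler-sum 0 k)) (euler-Φ k)) }
    where open Stage stage₀
  realize (suc d) h h≥0 h₀ = result (collect-empty-or-Any blocks m nonempty)
    where
    open Stage (stage d)
    open Step (stage d) using (⌊d/2⌋≤m; q-first-Φ; qFam-Ψ′)
    D m : ℕ
    D = suc d
    m = ⌊ D /2⌋
    blocks : ℕ → List (Family (V C))
    blocks s = copies ℤ.∣ h (suc s) ∣ (qFam s)
    as : List (ℕ × Family (V C))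
    as = collect blocks m
    nonempty : ∀ s → s < m → blocks s ≡ [] ⊎ Any (HasFace (pred m)) (blocks s)
    nonempty s s<m = copies-Any ℤ.∣ h (suc s) ∣ (qFam-face s (i≤⌊n/2⌋⇒i+i≤n D s<m))
    ad : All (Admissible C ⌊d/2⌋≤m) as
    ad = All.map (λ { (s<m , sub , link) → ℕₚ.≤-trans (s≤s z≤n) s<m , sub , link })
           (collect-All blocks (λ s → copies-All ℤ.∣ h (suc s) ∣ (qFam-sub s)) m)
    total : ∀ k → sumTo m (λ s → h s * q½ D s k) ≡ Φ D (fv (face C)) k + Ψtail D 0 as k
    total k = trans (tailSum-all m (λ s → h s * q½ D s k)) (cong₂ _+_
      (trans (cong (_* q½ D 0 k) h₀) (trans (ℤₚ.*-identityˡ (q½ D 0 k)) (q-first-Φ k)))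
      (sym (Ψtail-collect D blocks (λ s → h (suc s) * q½ D (suc s) k) 0 m k block)))
      where
      block : ∀ s → s < m → Ψ D (blocks s) k ≡ h (suc s) * q½ D (suc s) k
      -- The number of copies is the absolute value of the coefficient of h, which is the
      -- coefficient itself by nonnegativity.
      block s s<m = trans (Ψ-copies D ℤ.∣ h (suc s) ∣ (qFam s) k) (cong₂ _*_
        (ℤₚ.0≤i⇒+∣i∣≡i (h≥0 (suc s) (ℕₚ.≤-trans s<m (ℕₚ.⌊n/2⌋≤n D)))) (qFam-Ψ′ k s s<m))
    result : as ≡ [] ⊎ (0 < m × Any (HasFace (pred m) ∘ proj₂) as) →
      Realization D (λ k → sumTo m (λ s → h s * q½ D s k))
    result (inj₁ as≡[]) = record
      { M = ⌊ d /2⌋ ; M≤d/2 = ⌊d/2⌋≤m ; K = C ; K-face = C-face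
      ; a-Φ = λ k → trans (total k) (trans
          (cong (λ z → Φ D (fv (face C)) k + z)
            (trans (cong (λ z → Ψtail D 0 z k) as≡[]) (Φ-shiftℕ-zero D k)))
          (ℤₚ.+-identityʳ (Φ D (fv (face C)) k))) }
    result (inj₂ (0<m , faces)) = record
      { M = m ; M≤d/2 = ℕₚ.≤-refl ; K = extend C ⌊d/2⌋≤m as ad
      ; K-face = subst (λ z → HasFace z (attach 0 (face C) as)) (ℕₚ.suc-pred m {{ℕ.>-nonZero 0<m}})
                   (attach-face⁺ (face C) as faces)
      ; a-Φ = λ k → trans (total k) (sym (trans (Φ-cong D (fv-attach 0 (face C) as) k)
          (Φ-+ D (fv (face C)) (shiftℕ (tailF 0 as)) k))) }

  realize-sd : (Δ : BooleanCellComplex) →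
    Nonnegative (dΔ Δ) (hVecΔ Δ) → Symmetric (dΔ Δ) (hVecΔ Δ) →
    Realization (dΔ Δ) (hVec (dΔ Δ) (fVecOf (BooleanCellComplex.n Δ) (sdFace Δ)))
  realize-sd Δ h≥0 h-sym = record
    { M = M ; M≤d/2 = M≤d/2 ; K = K ; K-face = K-face ; a-Φ = λ k → trans (h-sd k) (a-Φ k) }
    where
    open BooleanCellComplex Δ using (rank)
    open Poset Δ
    d : ℕ
    d = dΔ Δ
    open Realization (realize d (hVecΔ Δ) h≥0 (cong (λ z → + 1 * + z) fVecΔ-zero))
    h-sd : ∀ k → hVec d (fVecOf (BooleanCellComplex.n Δ) (sdFace Δ)) k
               ≡ sumTo ⌊ d /2⌋ (λ s → hVecΔ Δ s * q½ d s k)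
    h-sd k = trans (hVec-cong d fVec-sd k)
      (trans (hVec-sd d rank faces (All.tabulate (λ {F} _ → rank≤d F)) k)
             (fold-symmetric d (hVecΔ Δ) h-sym k))

open Construction

-- The γ-vector of the barycentric subdivision.

open import Data.Integer.Base using (ℤ; +_)

theorem1p3 : (Δ : BooleanCellComplex) →
    Nonnegative (dΔ Δ) (hVecΔ Δ) → Symmetric (dΔ Δ) (hVecΔ Δ) →
    Symmetric (dSd Δ) (hVecSd Δ) ×
    Σ (ℕ → ℤ) (λ γ → IsGammaVector (dSd Δ) (hVecSd Δ) γ ×
    Σ SimplicialComplex (λ K → Balanced K ×
    (∀ i → i ≤ ⌊ dSd Δ /2⌋ → + fVec K i ≡ γ i) ×
    (∀ i → ⌊ dSd Δ /2⌋ < i → fVec K i ≡ 0)))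
theorem1p3 Δ h≥0 h-sym = conclude (dSd Δ) (Poset.dSd≡dΔ Δ)
  where
  open Realization (realize-sd Δ h≥0 h-sym)
  f : ℕ → ℕ
  f = fVecOf (BooleanCellComplex.n Δ) (sdFace Δ)
  -- The dimension of the subdivision is made a variable, with `f` fixed, so that its equality with
  -- that of Δ can be matched.
  conclude : ∀ d → d ≡ dΔ Δ → Symmetric d (hVec d f) ×
    Σ (ℕ → ℤ) (λ γ → IsGammaVector d (hVec d f) γ ×
    Σ SimplicialComplex (λ K → Balanced K ×
    (∀ i → i ≤ ⌊ d /2⌋ → + fVec K i ≡ γ i) ×
    (∀ i → ⌊ d /2⌋ < i → fVec K i ≡ 0)))
  conclude d refl =
      -- Symmetry follows from the γ-expansion, whose basis polynomials are palindromic.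
      (λ k k≤d → trans (a-Φ k) (trans (Φ-sym d (fv (face K)) k k≤d) (sym (a-Φ (d ∸ k)))))
    , (λ i → + fv (face K) i)
    , (λ k _ → a-Φ k)
    , toSimplicialComplex K
    , balanced K K-face
    , (λ _ _ → refl)
    , (λ i lt → fVec-high K i (ℕₚ.≤-<-trans M≤d/2 lt))
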